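{- Let $p,q$ be coprime positive integers, and set $a_m:=S_m(p,q)$ and $G_{p,q}(z)=\sum_{m\ge0}a_mz^m$. For each $\omega\in\mathbb{C}$ with $\omega^{pq}=1$, let $R(\omega):=\operatorname{Res}_{z=\omega}G_{p,q}(z)$. Then the finite Fourier transform $\widehat a(\omega)$ and the residue are related by $$\widehat a(\omega)=-pq\,\omega^{pq-1}R(\omega),$$ and consequently the variance equals the sum of squared moduli of the residues: $$\frac{1}{pq}\sum_{m=0}^{pq-1}|a_m|^2=\sum_{\omega^{pq}=1}|R(\omega)|^2.$$
   Context: For coprime positive integers $p,q$ and an integer $m$, $S_m(p,q)=\sum_{\zeta\in\mathcal{Z}_{p,q}}\zeta^m$, where $\mathcal{Z}_{p,q}=\{\zeta\in\mathbb{C}:\zeta^{pq}=1,\ \zeta^p\ne1,\ \zeta^q\ne1\}$ is the set of zeros of the Alexander polynomial of the torus knot $T_{p,q}$; the sequence is $pq$-periodic in $m$. $G_{p,q}(z)$ is defined by its power series for $|z|<1$ and extended meromorphically to $\mathbb{C}$. For an $N$-periodic complex sequence $(a_m)$ and an $N$-th root of unity $\omega$, $\widehat a(\omega):=\sum_{m=0}^{N-1}a_m\omega^m$ (here $N=pq$). -}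

module Defs where

open import Level using (0ℓ)
open import Algebra.Bundles using (RawRing)
open import Algebra.Bundles.Raw using (RawMonoid)
import Algebra.Definitions.RawMonoid as RawMonoidOps
import Algebra.Definitions.RawSemiring as RawSemiringOps
open import Data.Fin.Base using (zero; toℕ)
open import Data.Integer.Base using (+_)
open import Data.List.Base using (List; map; foldr)
import Data.List.Membership.Setoid as Membership
import Data.List.Relation.Unary.Unique.Setoid as UniqueSetoid
open import Data.List.Relation.Unary.All using (All)
open import Data.Nat.Base as ℕ using (ℕ; suc)
import Data.Nat.Properties as ℕₚ
open import Data.Product.Base using (Σ-syntax; ∃-syntax; _×_; _,_)
open import Data.Rational.Base as ℚ using (ℚ; 0ℚ; 1ℚ)
import Data.Rational.Properties as ℚₚ
open import Data.Rational.Solver using (module +-*-Solver)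
open import Data.Vec.Functional using (Vector)
open import Relation.Binary.Bundles using (Setoid)
open import Relation.Binary.PropositionalEquality using (_≡_; refl; sym; trans; cong; cong₂; subst; subst₂)
open import Relation.Nullary.Negation.Core using (¬_)

------------------------------------------------------------------------
-- Real numbers: Cauchy sequences of rationals, with equality a setoid
-- relation.

private
  dist : ℚ → ℚ → ℚ
  dist x y = ℚ.∣ x ℚ.- y ∣

IsCauchy : (ℕ → ℚ) → Set
IsCauchy x = ∀ ε → 0ℚ ℚ.< ε →
  ∃[ M ] (∀ m n → M ℕ.≤ m → M ℕ.≤ n → ℚ.∣ x m ℚ.- x n ∣ ℚ.< ε)

record ℝ : Set where
  constructor mkℝ
  field
    seq    : ℕ → ℚ
    cauchy : IsCauchy seq

open ℝ public

infix 4 _≈ʳ_ _<ʳ_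

record _≈ʳ_ (x y : ℝ) : Set where
  constructor mk≈
  field
    eventually-close : ∀ ε → 0ℚ ℚ.< ε →
      ∃[ M ] (∀ n → M ℕ.≤ n → ℚ.∣ seq x n ℚ.- seq y n ∣ ℚ.< ε)

open _≈ʳ_ public

-- Eventual strict inequality of the approximations is not enough: the
-- gap must be bounded below.
record _<ʳ_ (x y : ℝ) : Set where
  constructor mk<
  field
    gap   : ℚ
    gap>0 : 0ℚ ℚ.< gap
    eventually-apart : ∃[ M ] (∀ n → M ℕ.≤ n → seq x n ℚ.+ gap ℚ.< seq y n)

private
  dist-self : ∀ x → dist x x ≡ 0ℚ
  dist-self x = cong ℚ.∣_∣ (ℚₚ.+-inverseʳ x)

  dist-sym : ∀ x y → dist x y ≡ dist y x
  dist-sym x y = trans (sym (ℚₚ.∣-p∣≡∣p∣ (x ℚ.- y))) (cong ℚ.∣_∣ lemma)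
    where
    open +-*-Solver
    lemma : ℚ.- (x ℚ.- y) ≡ y ℚ.- x
    lemma = solve 2 (λ a b → :- (a :- b) := b :- a) refl x y

  dist-tri : ∀ x y z → dist x z ℚ.≤ dist x y ℚ.+ dist y z
  dist-tri x y z = subst (ℚ._≤ dist x y ℚ.+ dist y z) (cong ℚ.∣_∣ lemma)
                     (ℚₚ.∣p+q∣≤∣p∣+∣q∣ (x ℚ.- y) (y ℚ.- z))
    where
    open +-*-Solver
    lemma : (x ℚ.- y) ℚ.+ (y ℚ.- z) ≡ x ℚ.- z
    lemma = solve 3 (λ a b c → (a :- b) :+ (b :- c) := a :- c) refl x y z

  pos* : ∀ {x y} → 0ℚ ℚ.< x → 0ℚ ℚ.< y → 0ℚ ℚ.< x ℚ.* y
  pos* {x} {y} x>0 y>0 = ℚₚ.positive⁻¹ (x ℚ.* y)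
    {{ℚₚ.pos*pos⇒pos x {{ℚ.positive x>0}} y {{ℚ.positive y>0}}}}

  half : ℚ → ℚ
  half ε = ε ℚ.* ℚ.½

  half>0 : ∀ {ε} → 0ℚ ℚ.< ε → 0ℚ ℚ.< half ε
  half>0 ε>0 = pos* ε>0 (ℚₚ.positive⁻¹ ℚ.½)

  half+half : ∀ ε → half ε ℚ.+ half ε ≡ ε
  half+half ε = trans (sym (ℚₚ.*-distribˡ-+ ε ℚ.½ ℚ.½)) (ℚₚ.*-identityʳ ε)

  <-halves : ∀ x y ε → x ℚ.< half ε → y ℚ.< half ε → x ℚ.+ y ℚ.< ε
  <-halves x y ε p q = subst (x ℚ.+ y ℚ.<_) (half+half ε) (ℚₚ.+-mono-< p q)

≈ʳ-refl : ∀ {x} → x ≈ʳ x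
≈ʳ-refl {x} = mk≈ λ ε ε>0 → 0 , λ n _ → subst (ℚ._< ε) (sym (dist-self (seq x n))) ε>0

≈ʳ-sym : ∀ {x y} → x ≈ʳ y → y ≈ʳ x
≈ʳ-sym {x} {y} x≈y = mk≈ λ ε ε>0 →
  let M , h = eventually-close x≈y ε ε>0 in
  M , λ n M≤n → subst (ℚ._< ε) (dist-sym (seq x n) (seq y n)) (h n M≤n)

≈ʳ-trans : ∀ {x y z} → x ≈ʳ y → y ≈ʳ z → x ≈ʳ z
≈ʳ-trans {x} {y} {z} x≈y y≈z = mk≈ λ ε ε>0 →
  let M  , h  = eventually-close x≈y (half ε) (half>0 ε>0)
      M′ , h′ = eventually-close y≈z (half ε) (half>0 ε>0)
  in M ℕ.⊔ M′ , λ n le →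
    ℚₚ.≤-<-trans (dist-tri (seq x n) (seq y n) (seq z n))
      (<-halves (dist (seq x n) (seq y n)) (dist (seq y n) (seq z n)) ε
        (h n (ℕₚ.≤-trans (ℕₚ.m≤m⊔n M M′) le)) (h′ n (ℕₚ.≤-trans (ℕₚ.m≤n⊔m M M′) le)))

ofℚ : ℚ → ℝ
ofℚ r = mkℝ (λ _ → r) λ ε ε>0 → 0 , λ _ _ _ _ → subst (ℚ._< ε) (sym (dist-self r)) ε>0

infixl 6 _+ʳ_ _-ʳ_
infixl 7 _*ʳ_
infix  8 -ʳ_

private
  dist-+ : ∀ a b c d → dist (a ℚ.+ b) (c ℚ.+ d) ℚ.≤ dist a c ℚ.+ dist b d
  dist-+ a b c d = subst (ℚ._≤ dist a c ℚ.+ dist b d) (cong ℚ.∣_∣ lemma)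
                     (ℚₚ.∣p+q∣≤∣p∣+∣q∣ (a ℚ.- c) (b ℚ.- d))
    where
    open +-*-Solver
    lemma : (a ℚ.- c) ℚ.+ (b ℚ.- d) ≡ (a ℚ.+ b) ℚ.- (c ℚ.+ d)
    lemma = solve 4 (λ a b c d → (a :- c) :+ (b :- d) := (a :+ b) :- (c :+ d)) refl a b c d

  dist-neg : ∀ a b → dist (ℚ.- a) (ℚ.- b) ≡ dist b a
  dist-neg a b = cong ℚ.∣_∣ lemma
    where
    open +-*-Solver
    lemma : (ℚ.- a) ℚ.- (ℚ.- b) ≡ b ℚ.- a
    lemma = solve 2 (λ a b → (:- a) :- (:- b) := b :- a) refl a b

  dist-* : ∀ a b c d →
    dist (a ℚ.* b) (c ℚ.* d) ℚ.≤ ℚ.∣ a ∣ ℚ.* dist b d ℚ.+ ℚ.∣ d ∣ ℚ.* dist a c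
  dist-* a b c d = subst₂ ℚ._≤_ (cong ℚ.∣_∣ lemma)
    (cong₂ ℚ._+_ (ℚₚ.∣p*q∣≡∣p∣*∣q∣ a (b ℚ.- d)) (ℚₚ.∣p*q∣≡∣p∣*∣q∣ d (a ℚ.- c)))
    (ℚₚ.∣p+q∣≤∣p∣+∣q∣ (a ℚ.* (b ℚ.- d)) (d ℚ.* (a ℚ.- c)))
    where
    open +-*-Solver
    lemma : a ℚ.* (b ℚ.- d) ℚ.+ d ℚ.* (a ℚ.- c) ≡ a ℚ.* b ℚ.- c ℚ.* d
    lemma = solve 4 (λ a b c d → a :* (b :- d) :+ d :* (a :- c) := a :* b :- c :* d) refl a b c d

private
  abstract
    +-cauchy : ∀ x y → IsCauchy (λ n → seq x n ℚ.+ seq y n)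
    +-cauchy x y ε ε>0 with cauchy x (half ε) (half>0 ε>0) | cauchy y (half ε) (half>0 ε>0)
    ... | M , h | M′ , h′ = M ℕ.⊔ M′ , λ m n lm ln →
      ℚₚ.≤-<-trans (dist-+ (seq x m) (seq y m) (seq x n) (seq y n))
        (<-halves (dist (seq x m) (seq x n)) (dist (seq y m) (seq y n)) ε
          (h m n (ℕₚ.≤-trans (ℕₚ.m≤m⊔n M M′) lm) (ℕₚ.≤-trans (ℕₚ.m≤m⊔n M M′) ln))
          (h′ m n (ℕₚ.≤-trans (ℕₚ.m≤n⊔m M M′) lm) (ℕₚ.≤-trans (ℕₚ.m≤n⊔m M M′) ln)))

_+ʳ_ : ℝ → ℝ → ℝ
x +ʳ y = mkℝ (λ n → seq x n ℚ.+ seq y n) (+-cauchy x y)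

private
  abstract
    neg-cauchy : ∀ x → IsCauchy (λ n → ℚ.- seq x n)
    neg-cauchy x ε ε>0 with cauchy x ε ε>0
    ... | M , h = M , λ m n lm ln →
      subst (ℚ._< ε) (sym (dist-neg (seq x m) (seq x n))) (h n m ln lm)

-ʳ_ : ℝ → ℝ
-ʳ x = mkℝ (λ n → ℚ.- seq x n) (neg-cauchy x)

private
  bounded : ∀ x → ∃[ B ] 0ℚ ℚ.< B × ∃[ M ] (∀ n → M ℕ.≤ n → ℚ.∣ seq x n ∣ ℚ.≤ B)
  bounded x with cauchy x 1ℚ (ℚₚ.positive⁻¹ 1ℚ)
  ... | M , h = 1ℚ ℚ.+ ℚ.∣ seq x M ∣
              , ℚₚ.+-mono-<-≤ (ℚₚ.positive⁻¹ 1ℚ) (ℚₚ.0≤∣p∣ (seq x M))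
              , M , bound
    where
    open +-*-Solver
    split : ∀ a b → (a ℚ.- b) ℚ.+ b ≡ a
    split = solve 2 (λ a b → (a :- b) :+ b := a) refl

    bound : ∀ n → M ℕ.≤ n → ℚ.∣ seq x n ∣ ℚ.≤ 1ℚ ℚ.+ ℚ.∣ seq x M ∣
    bound n le = ℚₚ.≤-trans
      (subst (ℚ._≤ dist (seq x n) (seq x M) ℚ.+ ℚ.∣ seq x M ∣)
        (cong ℚ.∣_∣ (split (seq x n) (seq x M)))
        (ℚₚ.∣p+q∣≤∣p∣+∣q∣ (seq x n ℚ.- seq x M) (seq x M)))
      (ℚₚ.+-monoˡ-≤ ℚ.∣ seq x M ∣ (ℚₚ.<⇒≤ (h n M le ℕₚ.≤-refl)))

  shrink : ∀ B → 0ℚ ℚ.< B → ∀ ε → 0ℚ ℚ.< ε → ∃[ δ ] 0ℚ ℚ.< δ × B ℚ.* δ ≡ half ε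
  shrink B B>0 ε ε>0 =
      1/B ℚ.* half ε
    , pos* (ℚₚ.positive⁻¹ 1/B {{ℚₚ.1/pos⇒pos B {{ℚ.positive B>0}}}}) (half>0 ε>0)
    , trans (sym (ℚₚ.*-assoc B 1/B (half ε)))
        (trans (cong (ℚ._* half ε) (ℚₚ.*-inverseʳ B {{nz}})) (ℚₚ.*-identityˡ (half ε)))
    where
    nz = ℚₚ.pos⇒nonZero B {{ℚ.positive B>0}}
    1/B = (ℚ.1/ B) {{nz}}

  *-< : ∀ u v B δ η → 0ℚ ℚ.< B → B ℚ.* δ ≡ η → 0ℚ ℚ.≤ v →
        u ℚ.≤ B → v ℚ.< δ → u ℚ.* v ℚ.< η
  *-< u v B δ η B>0 eq v≥0 u≤B v<δ = subst (u ℚ.* v ℚ.<_) eq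
    (ℚₚ.≤-<-trans
      (ℚₚ.*-monoʳ-≤-nonNeg v {{ℚ.nonNegative v≥0}} u≤B)
      (ℚₚ.*-monoʳ-<-pos B {{ℚ.positive B>0}} v<δ))

private
  abstract
    *-cauchy : ∀ x y → IsCauchy (λ n → seq x n ℚ.* seq y n)
    *-cauchy x y ε ε>0 =
      let B  , B>0  , K  , b  = bounded x
          B′ , B′>0 , K′ , b′ = bounded y
          δ  , δ>0  , eq  = shrink B B>0 ε ε>0
          δ′ , δ′>0 , eq′ = shrink B′ B′>0 ε ε>0
          M  , h  = cauchy x δ′ δ′>0
          M′ , h′ = cauchy y δ δ>0
          K≤  = ℕₚ.≤-trans (ℕₚ.m≤m⊔n K K′) (ℕₚ.m≤m⊔n (K ℕ.⊔ K′) (M ℕ.⊔ M′))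
          K′≤ = ℕₚ.≤-trans (ℕₚ.m≤n⊔m K K′) (ℕₚ.m≤m⊔n (K ℕ.⊔ K′) (M ℕ.⊔ M′))
          M≤  = ℕₚ.≤-trans (ℕₚ.m≤m⊔n M M′) (ℕₚ.m≤n⊔m (K ℕ.⊔ K′) (M ℕ.⊔ M′))
          M′≤ = ℕₚ.≤-trans (ℕₚ.m≤n⊔m M M′) (ℕₚ.m≤n⊔m (K ℕ.⊔ K′) (M ℕ.⊔ M′))
      in (K ℕ.⊔ K′) ℕ.⊔ (M ℕ.⊔ M′) , λ m n lm ln →
        ℚₚ.≤-<-trans (dist-* (seq x m) (seq y m) (seq x n) (seq y n))
          (<-halves (ℚ.∣ seq x m ∣ ℚ.* dist (seq y m) (seq y n))
                    (ℚ.∣ seq y n ∣ ℚ.* dist (seq x m) (seq x n)) ε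
            (*-< ℚ.∣ seq x m ∣ (dist (seq y m) (seq y n)) B δ (half ε) B>0 eq
              (ℚₚ.0≤∣p∣ (seq y m ℚ.- seq y n)) (b m (ℕₚ.≤-trans K≤ lm))
              (h′ m n (ℕₚ.≤-trans M′≤ lm) (ℕₚ.≤-trans M′≤ ln)))
            (*-< ℚ.∣ seq y n ∣ (dist (seq x m) (seq x n)) B′ δ′ (half ε) B′>0 eq′
              (ℚₚ.0≤∣p∣ (seq x m ℚ.- seq x n)) (b′ n (ℕₚ.≤-trans K′≤ ln))
              (h m n (ℕₚ.≤-trans M≤ lm) (ℕₚ.≤-trans M≤ ln))))

_*ʳ_ : ℝ → ℝ → ℝ
x *ʳ y = mkℝ (λ n → seq x n ℚ.* seq y n) (*-cauchy x y)

_-ʳ_ : ℝ → ℝ → ℝ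
x -ʳ y = x +ʳ (-ʳ y)

recip : (n : ℕ) .{{_ : ℕ.NonZero n}} → ℝ
recip n = ofℚ ((+ 1) ℚ./ n)

∑ʳ< : ℕ → (ℕ → ℝ) → ℝ
∑ʳ< n f = RawMonoidOps.sum +ʳ-rawMonoid {n} (λ i → f (toℕ i))
  where
  +ʳ-rawMonoid : RawMonoid 0ℓ 0ℓ
  +ʳ-rawMonoid = record { Carrier = ℝ ; _≈_ = _≈ʳ_ ; _∙_ = _+ʳ_ ; ε = ofℚ 0ℚ }

------------------------------------------------------------------------
-- Complex numbers

infix 4 _≈ᶜ_

record ℂ : Set where
  constructor _+i_
  field
    re im : ℝ

open ℂ public

record _≈ᶜ_ (z w : ℂ) : Set where
  constructor _,_
  field
    re≈ : re z ≈ʳ re w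
    im≈ : im z ≈ʳ im w

ℂ-setoid : Setoid 0ℓ 0ℓ
ℂ-setoid = record
  { Carrier = ℂ
  ; _≈_ = _≈ᶜ_
  ; isEquivalence = record
    { refl  = ≈ʳ-refl , ≈ʳ-refl
    ; sym   = λ (p , q) → ≈ʳ-sym p , ≈ʳ-sym q
    ; trans = λ (p , q) (p′ , q′) → ≈ʳ-trans p p′ , ≈ʳ-trans q q′
    }
  }

ℂ-rawRing : RawRing 0ℓ 0ℓ
ℂ-rawRing = record
  { Carrier = ℂ
  ; _≈_ = _≈ᶜ_
  ; _+_ = λ z w → (re z +ʳ re w) +i (im z +ʳ im w)
  ; _*_ = λ z w → (re z *ʳ re w -ʳ im z *ʳ im w) +i (re z *ʳ im w +ʳ im z *ʳ re w)
  ; -_  = λ z → (-ʳ re z) +i (-ʳ im z)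
  ; 0#  = ofℚ 0ℚ +i ofℚ 0ℚ
  ; 1#  = ofℚ 1ℚ +i ofℚ 0ℚ
  }

open RawRing ℂ-rawRing public using (_≈_; _+_; _*_; -_; 0#; 1#; rawSemiring)
open RawSemiringOps rawSemiring public using (_^_; sum)

infixl 6 _-_

_-_ : ℂ → ℂ → ℂ
z - w = z + (- w)

ofℕ : ℕ → ℂ
ofℕ n = ofℚ ((+ n) ℚ./ 1) +i ofℚ 0ℚ

∣_∣² : ℂ → ℝ
∣ z ∣² = re z *ʳ re z +ʳ im z *ʳ im z

∑< : ℕ → (ℕ → ℂ) → ℂ
∑< n f = sum {n} (λ i → f (toℕ i))

------------------------------------------------------------------------
-- Finite subsets of ℂ, given by a repetition-free list of all elements,
-- and sums over them.  Such a list is unique up to order (and ≈).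

record Enumeration (P : ℂ → Set) : Set where
  open Membership ℂ-setoid using (_∈_)
  open UniqueSetoid ℂ-setoid using (Unique)
  field
    elements : List ℂ
    sound    : All P elements
    complete : ∀ z → P z → z ∈ elements
    unique   : Unique elements

open Enumeration public using (elements)

∑∈ : ∀ {P} → Enumeration P → (ℂ → ℂ) → ℂ
∑∈ E f = foldr _+_ 0# (map f (elements E))

∑ʳ∈ : ∀ {P} → Enumeration P → (ℂ → ℝ) → ℝ
∑ʳ∈ E f = foldr _+ʳ_ (ofℚ 0ℚ) (map f (elements E))

------------------------------------------------------------------------
-- Series, power series expansions and meromorphic functions

record HasSum (c : ℕ → ℂ) (s : ℂ) : Set where
  field
    converges : ∀ ε → 0ℚ ℚ.< ε →
      ∃[ M ] (∀ n → M ℕ.≤ n → ∣ ∑< n c - s ∣² <ʳ ofℚ (ε ℚ.* ε))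

-- |z - z₀| < r for a positive rational r, with both sides squared.
InDisc : ℂ → ℚ → ℂ → Set
InDisc z₀ r z = ∣ z - z₀ ∣² <ʳ ofℚ (r ℚ.* r)

-- Functions with singularities have to be partial, since equality on ℂ
-- is undecidable and no junk value can be assigned at the singularities.
record PartialFunction : Set₁ where
  field
    Dom   : ℂ → Set
    value : ∀ z → Dom z → ℂ
    value-cong : ∀ {z w} (d : Dom z) (e : Dom w) → z ≈ w → value z d ≈ value w e

open PartialFunction public

-- z ∈ Dom f and f(z) = ∑ₙ cₙ.
ValueIsSum : (f : PartialFunction) (z : ℂ) → (ℕ → ℂ) → Set
ValueIsSum f z c = Σ[ d ∈ Dom f z ] HasSum c (value f z d)

record TaylorAt (f : PartialFunction) (z₀ : ℂ) : Set where
  field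
    radius    : ℚ
    radius>0  : 0ℚ ℚ.< radius
    coeff     : ℕ → ℂ
    expansion : ∀ z → InDisc z₀ radius z → ValueIsSum f z (λ n → coeff n * (z - z₀) ^ n)

-- In expansion, w = (z - z₀)⁻¹; its existence is what makes the disc
-- punctured.  The index j of principal is the coefficient of
-- (z - z₀)^-(j+1).  Leading coefficients may vanish, so at a regular point
-- order = 0 with principal part 0 is allowed.
record LaurentAt (f : PartialFunction) (z₀ : ℂ) : Set where
  field
    radius    : ℚ
    radius>0  : 0ℚ ℚ.< radius
    order     : ℕ
    principal : Vector ℂ (suc order)
    coeff     : ℕ → ℂ
    expansion : ∀ z w → InDisc z₀ radius z → w * (z - z₀) ≈ 1# →
      Σ[ d ∈ Dom f z ]
        HasSum (λ n → coeff n * (z - z₀) ^ n)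
               (value f z d - sum (λ j → principal j * w ^ suc (toℕ j)))

HasResidue : PartialFunction → ℂ → ℂ → Set
HasResidue f z₀ ρ = Σ[ L ∈ LaurentAt f z₀ ] LaurentAt.principal L zero ≈ ρ

-- Meromorphic on all of ℂ.  Local finiteness makes the set of poles closed
-- and discrete.  Points off the poles are taken at positive distance from
-- them, which for such a set is classically the same as not being a pole;
-- constructively one cannot decide for each z which case applies.
record IsMeromorphic (f : PartialFunction) : Set₁ where
  open Membership ℂ-setoid using (_∈_)
  field
    Pole           : ℂ → Set
    locally-finite : ∀ r → Σ[ ps ∈ List ℂ ] (∀ p → Pole p → InDisc 0# r p → p ∈ ps)
    at-poles       : ∀ p → Pole p → LaurentAt f p
    off-poles      : ∀ z →
      (∃[ δ ] 0ℚ ℚ.< δ × (∀ p → Pole p → ofℚ δ <ʳ ∣ z - p ∣²)) →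
      TaylorAt f z

-- f is a meromorphic function on ℂ equal to ∑ₘ aₘ zᵐ for |z| < 1.
record IsMeromorphicExtension (a : ℕ → ℂ) (f : PartialFunction) : Set₁ where
  field
    meromorphic : IsMeromorphic f
    extends     : ∀ z → ∣ z ∣² <ʳ ofℚ 1ℚ → ValueIsSum f z (λ m → a m * z ^ m)

------------------------------------------------------------------------
-- Roots of unity, torus knots and the finite Fourier transform

RootOfUnity : ℕ → ℂ → Set
RootOfUnity N ω = ω ^ N ≈ 1#

-- The zeros of the Alexander polynomial of the torus knot T(p,q).
AlexanderZero : ℕ → ℕ → ℂ → Set
AlexanderZero p q ζ = ζ ^ (p ℕ.* q) ≈ 1# × ¬ (ζ ^ p ≈ 1#) × ¬ (ζ ^ q ≈ 1#)

S : ∀ p q → Enumeration (AlexanderZero p q) → ℕ → ℂ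
S p q Z m = ∑∈ Z (λ ζ → ζ ^ m)

fourier : ℕ → (ℕ → ℂ) → ℂ → ℂ
fourier N a ω = ∑< N (λ m → a m * ω ^ m)

{-# OPTIONS --safe #-}

-- Let N = pq.  For |z| < 1 the N-periodicity of the coefficients gives (1 − z^N) G(z) = P(z) with
-- P(z) = Σ_{m<N} a_m z^m, by shifting partial sums.  Let z = ω + xh tend radially to the root of unity ω
-- as x → 0⁺.  Then x G(z) stays bounded, whereas the Laurent expansion writes it as a polynomial in 1/x
-- plus x times a bounded term; so this polynomial is constant and only the residue survives in the
-- limit, where (1 − z^N) G(z) = P(z) becomes P(ω) = − N ω^(N−1) R(ω).
--
-- For the variance, a is a sum of characters: P(ω) = Σ_ζ D(ζω) with D(η) = Σ_{m<N} η^m, which is N at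
-- η = 1 and 0 at every other N-th root of unity.  As μ contains each conjugate of a ζ exactly once,
-- Σ_ω |P(ω)|² = Σ_ζ N conj(P(conj ζ)) = N Σ_m |a_m|².
module Submission where

open import Defs
open import Algebra.Bundles using (CommutativeRing)
import Algebra.Solver.Ring
import Algebra.Solver.Ring.AlmostCommutativeRing as ACR
open import Data.Fin.Base using (zero; suc; toℕ)
open import Data.Integer.Base as ℤ using (+_)
import Data.Integer.Properties as ℤₚ
open import Data.List.Base using (List; []; _∷_; map; foldr)
import Data.List.Membership.Setoid as Membership
open import Data.List.Relation.Unary.All as All using (All; []; _∷_)
open import Data.List.Relation.Unary.AllPairs using (_∷_)
open import Data.List.Relation.Unary.Any using (here; there)
import Data.List.Relation.Unary.Unique.Setoid as UniqueSetoid
open import Data.Maybe.Base using (Maybe; just; nothing)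
open import Data.Nat.Base as ℕ using (ℕ; zero; suc; NonZero; _∸_)
open import Data.Nat.Coprimality as Coprimality using (Coprime)
import Data.Nat.Properties as ℕₚ
open import Data.Nat.Properties using (m*n≢0)
open import Data.Product.Base using (∃-syntax; _×_; _,_; proj₁; proj₂)
open import Data.Rational.Base as ℚ using (ℚ; 0ℚ; 1ℚ; mkℚ)
import Data.Rational.Properties as ℚₚ
import Data.Rational.Solver as ℚ-Solver
import Data.Rational.Unnormalised.Base as ℚᵘ
import Data.Rational.Unnormalised.Properties as ℚᵘₚ
open import Data.Sum.Base using (inj₁; inj₂)
open import Data.Vec.Functional using (Vector; tail)
open import Function.Base using (_∘_)
open import Level using (0ℓ)
open import Relation.Binary.PropositionalEquality as ≡ using (_≡_)
open import Relation.Nullary using (¬_; yes; no; contradiction)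

-- Equality on ℂ is undecidable, so every passage to the limit is an estimate proportional to a
-- rational `x` > 0 with explicit rational constants: a fixed number with such a bound for all small
-- `x` is 0. The order of the pole is whatever the given Laurent expansion declares, so the higher
-- principal coefficients cannot be assumed to vanish. Boundedness of x G(z) rests on the choice z =
-- ρω with ρ = 1 - s x a positive rational: then 1 - z^N = s x (1 + ρ + ... + ρ^(N-1)), and the last
-- factor is at least 1, so that removing it from a bound is a comparison of norms and not a
-- division. The regular part of the expansion is controlled by its terms at x = 1, from which the
-- terms at smaller `x` arise by factors x^n. In the variance, an entry of an enumeration cannot be
-- tested for being conj ζ; the proof of membership supplies its position and repetition-freeness
-- excludes the other entries.

private
  module ℚ-solver = ℚ-Solver.+-*-Solver

-- Rational inequalities

*-pos : ∀ {p q} → 0ℚ ℚ.< p → 0ℚ ℚ.< q → 0ℚ ℚ.< p ℚ.* q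
*-pos {p} {q} p>0 q>0 = ℚₚ.positive⁻¹ (p ℚ.* q)
  {{ℚₚ.pos*pos⇒pos p {{ℚ.positive p>0}} q {{ℚ.positive q>0}}}}

*-nonNeg : ∀ {p q} → 0ℚ ℚ.≤ p → 0ℚ ℚ.≤ q → 0ℚ ℚ.≤ p ℚ.* q
*-nonNeg {p} {q} p≥0 q≥0 = ℚₚ.nonNegative⁻¹ (p ℚ.* q)
  {{ℚₚ.nonNeg*nonNeg⇒nonNeg p {{ℚ.nonNegative p≥0}} q {{ℚ.nonNegative q≥0}}}}

+-pos : ∀ {p q} → 0ℚ ℚ.< p → 0ℚ ℚ.< q → 0ℚ ℚ.< p ℚ.+ q
+-pos = ℚₚ.+-mono-<

+-nonNeg : ∀ {p q} → 0ℚ ℚ.≤ p → 0ℚ ℚ.≤ q → 0ℚ ℚ.≤ p ℚ.+ q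
+-nonNeg = ℚₚ.+-mono-≤

*-mono-≤ : ∀ {p q r s} → 0ℚ ℚ.≤ r → 0ℚ ℚ.≤ q → p ℚ.≤ q → r ℚ.≤ s → p ℚ.* r ℚ.≤ q ℚ.* s
*-mono-≤ {p} {q} {r} {s} r≥0 q≥0 p≤q r≤s = ℚₚ.≤-trans
  (ℚₚ.*-monoʳ-≤-nonNeg r {{ℚ.nonNegative r≥0}} p≤q)
  (ℚₚ.*-monoˡ-≤-nonNeg q {{ℚ.nonNegative q≥0}} r≤s)

*-monoˡ-< : ∀ {p q r} → 0ℚ ℚ.< p → q ℚ.< r → p ℚ.* q ℚ.< p ℚ.* r
*-monoˡ-< {p} p>0 = ℚₚ.*-monoʳ-<-pos p {{ℚ.positive p>0}}

*-monoʳ-< : ∀ {p q r} → 0ℚ ℚ.< p → q ℚ.< r → q ℚ.* p ℚ.< r ℚ.* p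
*-monoʳ-< {p} p>0 = ℚₚ.*-monoˡ-<-pos p {{ℚ.positive p>0}}

inverse : ∀ {p} → 0ℚ ℚ.< p → ∃[ r ] 0ℚ ℚ.< r × p ℚ.* r ≡ 1ℚ
inverse {p} p>0 =
    (ℚ.1/ p) {{nz}}
  , ℚₚ.positive⁻¹ _ {{ℚₚ.1/pos⇒pos p {{ℚ.positive p>0}}}}
  , ℚₚ.*-inverseʳ p {{nz}}
  where nz = ℚₚ.pos⇒nonZero p {{ℚ.positive p>0}}

quotient : ∀ {p q} → 0ℚ ℚ.< p → 0ℚ ℚ.< q → ∃[ r ] 0ℚ ℚ.< r × p ℚ.* r ≡ q
quotient {p} {q} p>0 q>0 with inverse p>0
... | r , r>0 , pr≡1 = r ℚ.* q , *-pos r>0 q>0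
  , ≡.trans (≡.sym (ℚₚ.*-assoc p r q)) (≡.trans (≡.cong (ℚ._* q) pr≡1) (ℚₚ.*-identityˡ q))

halve : ∀ {ε} → 0ℚ ℚ.< ε → ∃[ δ ] 0ℚ ℚ.< δ × δ ℚ.+ δ ≡ ε
halve {ε} ε>0 = ε ℚ.* ℚ.½ , *-pos ε>0 (ℚₚ.positive⁻¹ ℚ.½)
  , ≡.trans (≡.sym (ℚₚ.*-distribˡ-+ ε ℚ.½ ℚ.½)) (ℚₚ.*-identityʳ ε)

∣p∣≡0⇒<ε : ∀ {p ε} → p ≡ 0ℚ → 0ℚ ℚ.< ε → ℚ.∣ p ∣ ℚ.< ε
∣p∣≡0⇒<ε ≡.refl ε>0 = ε>0

p≤∣p∣ : ∀ p → p ℚ.≤ ℚ.∣ p ∣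
p≤∣p∣ p with ℚₚ.≤-total 0ℚ p
... | inj₁ p≥0 = ℚₚ.≤-reflexive (≡.sym (ℚₚ.0≤p⇒∣p∣≡p p≥0))
... | inj₂ p≤0 = ℚₚ.≤-trans p≤0 (ℚₚ.0≤∣p∣ p)

-- Real numbers

Eventually : (ℕ → Set) → Set
Eventually P = ∃[ M ] (∀ n → M ℕ.≤ n → P n)

always : ∀ {P : ℕ → Set} → (∀ n → P n) → Eventually P
always p = 0 , λ n _ → p n

eventually-map : ∀ {P Q : ℕ → Set} → (∀ n → P n → Q n) → Eventually P → Eventually Q
eventually-map f (M , p) = M , λ n le → f n (p n le)

eventually-map₂ : ∀ {P Q R : ℕ → Set} → (∀ n → P n → Q n → R n) →
                  Eventually P → Eventually Q → Eventually R
eventually-map₂ f (M , p) (M′ , q) = M ℕ.⊔ M′ , λ n le →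
  f n (p n (ℕₚ.≤-trans (ℕₚ.m≤m⊔n M M′) le)) (q n (ℕₚ.≤-trans (ℕₚ.m≤n⊔m M M′) le))

eventually-× : ∀ {P Q : ℕ → Set} → Eventually P → Eventually Q → Eventually (λ n → P n × Q n)
eventually-× = eventually-map₂ (λ _ p q → p , q)

-- The operations act termwise on approximations, so ring identities reduce to identities in ℚ at
-- each index; only the congruences require ε-arguments.
pointwiseʳ : ∀ {x y} → (∀ n → seq x n ≡ seq y n) → x ≈ʳ y
pointwiseʳ {x} {y} eq = mk≈ λ ε ε>0 → always λ n →
  ∣p∣≡0⇒<ε (≡.trans (≡.cong (ℚ._- seq y n) (eq n)) (ℚₚ.+-inverseʳ (seq y n))) ε>0

seq-bounded : ∀ x → ∃[ B ] 0ℚ ℚ.< B × Eventually (λ n → ℚ.∣ seq x n ∣ ℚ.≤ B)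
seq-bounded x with cauchy x 1ℚ (ℚₚ.positive⁻¹ 1ℚ)
... | M , h = 1ℚ ℚ.+ ℚ.∣ seq x M ∣
            , ℚₚ.+-mono-<-≤ (ℚₚ.positive⁻¹ 1ℚ) (ℚₚ.0≤∣p∣ (seq x M))
            , M , λ n M≤n → begin
                ℚ.∣ seq x n ∣
                  ≡⟨ ≡.cong ℚ.∣_∣ (solve 2 (λ a b → a := (a :- b) :+ b) ≡.refl (seq x n) (seq x M)) ⟩
                ℚ.∣ (seq x n ℚ.- seq x M) ℚ.+ seq x M ∣
                  ≤⟨ ℚₚ.∣p+q∣≤∣p∣+∣q∣ (seq x n ℚ.- seq x M) (seq x M) ⟩
                ℚ.∣ seq x n ℚ.- seq x M ∣ ℚ.+ ℚ.∣ seq x M ∣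
                  ≤⟨ ℚₚ.+-monoˡ-≤ ℚ.∣ seq x M ∣ (ℚₚ.<⇒≤ (h n M M≤n ℕₚ.≤-refl)) ⟩
                1ℚ ℚ.+ ℚ.∣ seq x M ∣ ∎
  where
  open ℚₚ.≤-Reasoning
  open ℚ-solver

+ʳ-cong : ∀ {x x′ y y′} → x ≈ʳ x′ → y ≈ʳ y′ → x +ʳ y ≈ʳ x′ +ʳ y′
+ʳ-cong {x} {x′} {y} {y′} p q = mk≈ λ ε ε>0 →
  let δ , δ>0 , δ+δ≡ε = halve ε>0 in
  eventually-map₂ (λ n a b → begin-strict
      ℚ.∣ (seq x n ℚ.+ seq y n) ℚ.- (seq x′ n ℚ.+ seq y′ n) ∣
        ≡⟨ ≡.cong ℚ.∣_∣ (solve 4 (λ a b c d → (a :+ b) :- (c :+ d) := (a :- c) :+ (b :- d)) ≡.refl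
             (seq x n) (seq y n) (seq x′ n) (seq y′ n)) ⟩
      ℚ.∣ (seq x n ℚ.- seq x′ n) ℚ.+ (seq y n ℚ.- seq y′ n) ∣
        ≤⟨ ℚₚ.∣p+q∣≤∣p∣+∣q∣ (seq x n ℚ.- seq x′ n) (seq y n ℚ.- seq y′ n) ⟩
      ℚ.∣ seq x n ℚ.- seq x′ n ∣ ℚ.+ ℚ.∣ seq y n ℚ.- seq y′ n ∣
        <⟨ ℚₚ.+-mono-< a b ⟩
      δ ℚ.+ δ
        ≡⟨ δ+δ≡ε ⟩
      ε ∎)
    (eventually-close p δ δ>0) (eventually-close q δ δ>0)
  where
  open ℚₚ.≤-Reasoning
  open ℚ-solver

-ʳ-cong : ∀ {x y} → x ≈ʳ y → -ʳ x ≈ʳ -ʳ y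
-ʳ-cong {x} {y} p = mk≈ λ ε ε>0 → eventually-map
  (λ n → ≡.subst (ℚ._< ε) (≡.trans (≡.sym (ℚₚ.∣-p∣≡∣p∣ (seq x n ℚ.- seq y n)))
    (≡.cong ℚ.∣_∣ (solve 2 (λ a b → :- (a :- b) := (:- a) :- (:- b)) ≡.refl (seq x n) (seq y n)))))
  (eventually-close p ε ε>0)
  where open ℚ-solver

*ʳ-cong : ∀ {x x′ y y′} → x ≈ʳ x′ → y ≈ʳ y′ → x *ʳ y ≈ʳ x′ *ʳ y′
*ʳ-cong {x} {x′} {y} {y′} p q = mk≈ λ ε ε>0 →
  let η , η>0 , η+η≡ε = halve ε>0
      B , B>0 , x≤B = seq-bounded x
      C , C>0 , y′≤C = seq-bounded y′
      δ , δ>0 , Bδ≡η = quotient B>0 η>0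
      δ′ , δ′>0 , Cδ′≡η = quotient C>0 η>0
  in eventually-map₂ (λ n (u , v) (u′ , v′) → begin-strict
      ℚ.∣ seq x n ℚ.* seq y n ℚ.- seq x′ n ℚ.* seq y′ n ∣
        ≡⟨ ≡.cong ℚ.∣_∣ (solve 4 (λ a b c d → a :* b :- c :* d := a :* (b :- d) :+ d :* (a :- c)) ≡.refl
             (seq x n) (seq y n) (seq x′ n) (seq y′ n)) ⟩
      ℚ.∣ seq x n ℚ.* (seq y n ℚ.- seq y′ n) ℚ.+ seq y′ n ℚ.* (seq x n ℚ.- seq x′ n) ∣
        ≤⟨ ℚₚ.∣p+q∣≤∣p∣+∣q∣ (seq x n ℚ.* (seq y n ℚ.- seq y′ n)) (seq y′ n ℚ.* (seq x n ℚ.- seq x′ n)) ⟩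
      ℚ.∣ seq x n ℚ.* (seq y n ℚ.- seq y′ n) ∣ ℚ.+ ℚ.∣ seq y′ n ℚ.* (seq x n ℚ.- seq x′ n) ∣
        ≡⟨ ≡.cong₂ ℚ._+_ (ℚₚ.∣p*q∣≡∣p∣*∣q∣ (seq x n) (seq y n ℚ.- seq y′ n))
                          (ℚₚ.∣p*q∣≡∣p∣*∣q∣ (seq y′ n) (seq x n ℚ.- seq x′ n)) ⟩
      ℚ.∣ seq x n ∣ ℚ.* ℚ.∣ seq y n ℚ.- seq y′ n ∣ ℚ.+ ℚ.∣ seq y′ n ∣ ℚ.* ℚ.∣ seq x n ℚ.- seq x′ n ∣
        <⟨ ℚₚ.+-mono-< (product-< (ℚₚ.0≤∣p∣ (seq y n ℚ.- seq y′ n)) B>0 u u′)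
                       (product-< (ℚₚ.0≤∣p∣ (seq x n ℚ.- seq x′ n)) C>0 v v′) ⟩
      B ℚ.* δ ℚ.+ C ℚ.* δ′
        ≡⟨ ≡.cong₂ ℚ._+_ Bδ≡η Cδ′≡η ⟩
      η ℚ.+ η
        ≡⟨ η+η≡ε ⟩
      ε ∎)
    (eventually-× x≤B y′≤C)
    (eventually-× (eventually-close q δ δ>0) (eventually-close p δ′ δ′>0))
  where
  open ℚₚ.≤-Reasoning
  open ℚ-solver
  product-< : ∀ {a b c d} → 0ℚ ℚ.≤ b → 0ℚ ℚ.< c → a ℚ.≤ c → b ℚ.< d → a ℚ.* b ℚ.< c ℚ.* d
  product-< {b = b} b≥0 c>0 a≤c b<d = ℚₚ.≤-<-trans
    (ℚₚ.*-monoʳ-≤-nonNeg b {{ℚ.nonNegative b≥0}} a≤c) (*-monoˡ-< c>0 b<d)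

-- The commutative ring of complex numbers

pointwise : ∀ {z w} → (∀ n → seq (re z) n ≡ seq (re w) n) →
            (∀ n → seq (im z) n ≡ seq (im w) n) → z ≈ w
pointwise p q = pointwiseʳ p , pointwiseʳ q

module _ where
  open ℚ-solver

  +ᶜ-assoc : ∀ x y z → (x + y) + z ≈ x + (y + z)
  +ᶜ-assoc x y z = pointwise
    (λ n → ℚₚ.+-assoc (seq (re x) n) (seq (re y) n) (seq (re z) n))
    (λ n → ℚₚ.+-assoc (seq (im x) n) (seq (im y) n) (seq (im z) n))

  +ᶜ-comm : ∀ x y → x + y ≈ y + x
  +ᶜ-comm x y = pointwise
    (λ n → ℚₚ.+-comm (seq (re x) n) (seq (re y) n))
    (λ n → ℚₚ.+-comm (seq (im x) n) (seq (im y) n))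

  +ᶜ-identityˡ : ∀ x → 0# + x ≈ x
  +ᶜ-identityˡ x = pointwise
    (λ n → ℚₚ.+-identityˡ (seq (re x) n)) (λ n → ℚₚ.+-identityˡ (seq (im x) n))

  -ᶜ-inverseˡ : ∀ x → (- x) + x ≈ 0#
  -ᶜ-inverseˡ x = pointwise
    (λ n → ℚₚ.+-inverseˡ (seq (re x) n)) (λ n → ℚₚ.+-inverseˡ (seq (im x) n))

  *ᶜ-assoc : ∀ x y z → (x * y) * z ≈ x * (y * z)
  *ᶜ-assoc x y z = pointwise
    (λ n → solve 6 (λ a b c d e f →
        (a :* c :+ :- (b :* d)) :* e :+ :- ((a :* d :+ b :* c) :* f)
          := a :* (c :* e :+ :- (d :* f)) :+ :- (b :* (c :* f :+ d :* e))) ≡.refl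
      (seq (re x) n) (seq (im x) n) (seq (re y) n) (seq (im y) n) (seq (re z) n) (seq (im z) n))
    (λ n → solve 6 (λ a b c d e f →
        (a :* c :+ :- (b :* d)) :* f :+ (a :* d :+ b :* c) :* e
          := a :* (c :* f :+ d :* e) :+ b :* (c :* e :+ :- (d :* f))) ≡.refl
      (seq (re x) n) (seq (im x) n) (seq (re y) n) (seq (im y) n) (seq (re z) n) (seq (im z) n))

  *ᶜ-comm : ∀ x y → x * y ≈ y * x
  *ᶜ-comm x y = pointwise
    (λ n → solve 4 (λ a b c d → a :* c :+ :- (b :* d) := c :* a :+ :- (d :* b)) ≡.refl
      (seq (re x) n) (seq (im x) n) (seq (re y) n) (seq (im y) n))
    (λ n → solve 4 (λ a b c d → a :* d :+ b :* c := c :* b :+ d :* a) ≡.refl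
      (seq (re x) n) (seq (im x) n) (seq (re y) n) (seq (im y) n))

  *ᶜ-identityˡ : ∀ x → 1# * x ≈ x
  *ᶜ-identityˡ x = pointwise
    (λ n → solve 2 (λ a b → con 1ℚ :* a :+ :- (con 0ℚ :* b) := a) ≡.refl (seq (re x) n) (seq (im x) n))
    (λ n → solve 2 (λ a b → con 1ℚ :* b :+ con 0ℚ :* a := b) ≡.refl (seq (re x) n) (seq (im x) n))

  *ᶜ-distribˡ-+ : ∀ x y z → x * (y + z) ≈ x * y + x * z
  *ᶜ-distribˡ-+ x y z = pointwise
    (λ n → solve 6 (λ a b c d e f →
        a :* (c :+ e) :+ :- (b :* (d :+ f)) := (a :* c :+ :- (b :* d)) :+ (a :* e :+ :- (b :* f))) ≡.refl
      (seq (re x) n) (seq (im x) n) (seq (re y) n) (seq (im y) n) (seq (re z) n) (seq (im z) n))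
    (λ n → solve 6 (λ a b c d e f →
        a :* (d :+ f) :+ b :* (c :+ e) := (a :* d :+ b :* c) :+ (a :* f :+ b :* e)) ≡.refl
      (seq (re x) n) (seq (im x) n) (seq (re y) n) (seq (im y) n) (seq (re z) n) (seq (im z) n))

  +ᶜ-cong : ∀ {x x′ y y′} → x ≈ x′ → y ≈ y′ → x + y ≈ x′ + y′
  +ᶜ-cong (p , q) (p′ , q′) = +ʳ-cong p p′ , +ʳ-cong q q′

  -ᶜ-cong : ∀ {x y} → x ≈ y → - x ≈ - y
  -ᶜ-cong (p , q) = -ʳ-cong p , -ʳ-cong q

  *ᶜ-cong : ∀ {x x′ y y′} → x ≈ x′ → y ≈ y′ → x * y ≈ x′ * y′
  *ᶜ-cong (p , q) (p′ , q′) =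
      +ʳ-cong (*ʳ-cong p p′) (-ʳ-cong (*ʳ-cong q q′))
    , +ʳ-cong (*ʳ-cong p q′) (*ʳ-cong q p′)

ℂ-commutativeRing : CommutativeRing 0ℓ 0ℓ
ℂ-commutativeRing = record
  { Carrier = ℂ ; _≈_ = _≈_ ; _+_ = _+_ ; _*_ = _*_ ; -_ = -_ ; 0# = 0# ; 1# = 1#
  ; isCommutativeRing = record
    { isRing = record
      { +-isAbelianGroup = record
        { isGroup = record
          { isMonoid = record
            { isSemigroup = record
              { isMagma = record { isEquivalence = isEquivalence ; ∙-cong = +ᶜ-cong }
              ; assoc = +ᶜ-assoc }
            ; identity = +ᶜ-identityˡ , comm∧idˡ⇒idʳ +ᶜ-comm +ᶜ-identityˡ }
          ; inverse = -ᶜ-inverseˡ , comm∧invˡ⇒invʳ +ᶜ-comm -ᶜ-inverseˡ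
          ; ⁻¹-cong = -ᶜ-cong }
        ; comm = +ᶜ-comm }
      ; *-cong = *ᶜ-cong
      ; *-assoc = *ᶜ-assoc
      ; *-identity = *ᶜ-identityˡ , comm∧idˡ⇒idʳ *ᶜ-comm *ᶜ-identityˡ
      ; distrib = *ᶜ-distribˡ-+ , comm∧distrˡ⇒distrʳ +ᶜ-cong *ᶜ-comm *ᶜ-distribˡ-+ }
    ; *-comm = *ᶜ-comm } }
  where
  open import Relation.Binary.Bundles using (Setoid)
  open Setoid ℂ-setoid using (isEquivalence)
  open import Algebra.Consequences.Setoid ℂ-setoid

open CommutativeRing ℂ-commutativeRing public using
  ( refl; sym; trans; setoid; semiring; +-cong; +-congˡ; +-congʳ; *-cong; *-congˡ; *-congʳ; -‿cong
  ; +-identityˡ; +-identityʳ; *-identityˡ; *-identityʳ; zeroˡ; zeroʳ; *-comm; +-comm; *-assoc; +-assoc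
  ; distribˡ; distribʳ)

-- Embeddings of ℝ and ℚ in ℂ, and the ring solver

infix 9 ι_ κ_

ι_ : ℝ → ℂ
ι x = x +i ofℚ 0ℚ

κ_ : ℚ → ℂ
κ r = ι (ofℚ r)

κ-cong : ∀ {p q} → p ≡ q → κ p ≈ κ q
κ-cong ≡.refl = refl

κ-homo-+ : ∀ p q → κ (p ℚ.+ q) ≈ κ p + κ q
κ-homo-+ p q = pointwise (λ n → ≡.refl) (λ n → ≡.refl)

κ-homo-* : ∀ p q → κ (p ℚ.* q) ≈ κ p * κ q
κ-homo-* p q = pointwise
  (λ n → solve 2 (λ a b → a :* b := a :* b :+ :- (con 0ℚ :* con 0ℚ)) ≡.refl p q)
  (λ n → solve 2 (λ a b → con 0ℚ := a :* con 0ℚ :+ con 0ℚ :* b) ≡.refl p q)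
  where open ℚ-solver

κ-homo-neg : ∀ p → κ (ℚ.- p) ≈ - (κ p)
κ-homo-neg p = pointwise (λ n → ≡.refl) (λ n → ≡.refl)

-- The solver has to compare coefficients, which is impossible in ℂ; its coefficients are therefore
-- taken from ℚ.
_κ≟_ : ∀ p q → Maybe (κ p ≈ κ q)
p κ≟ q with p ℚₚ.≟ q
... | yes p≡q = just (κ-cong p≡q)
... | no _ = nothing

κ-morphism : ℚₚ.+-*-rawRing ACR.-Raw-AlmostCommutative⟶ ACR.fromCommutativeRing ℂ-commutativeRing
κ-morphism = record
  { ⟦_⟧ = κ_ ; +-homo = κ-homo-+ ; *-homo = κ-homo-* ; -‿homo = κ-homo-neg
  ; 0-homo = refl ; 1-homo = refl }

module ℂ-solver = Algebra.Solver.Ring ℚₚ.+-*-rawRing (ACR.fromCommutativeRing ℂ-commutativeRing) κ-morphism _κ≟_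

p≤p+q : ∀ {p q} → 0ℚ ℚ.≤ q → p ℚ.≤ p ℚ.+ q
p≤p+q {p} {q} q≥0 = ≡.subst (ℚ._≤ p ℚ.+ q) (ℚₚ.+-identityʳ p) (ℚₚ.+-monoʳ-≤ p q≥0)

q≤p+q : ∀ {p q} → 0ℚ ℚ.≤ p → q ℚ.≤ p ℚ.+ q
q≤p+q {p} {q} p≥0 = ≡.subst (ℚ._≤ p ℚ.+ q) (ℚₚ.+-identityˡ q) (ℚₚ.+-monoˡ-≤ q p≥0)

-- Bounds for complex numbers

-- The ℓ¹ norm of the approximations: submultiplicative, and free of square roots.
‖_‖ : ℂ → ℕ → ℚ
‖ z ‖ n = ℚ.∣ seq (re z) n ∣ ℚ.+ ℚ.∣ seq (im z) n ∣

0≤‖_‖ : ∀ z n → 0ℚ ℚ.≤ ‖ z ‖ n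
0≤‖ z ‖ n = +-nonNeg (ℚₚ.0≤∣p∣ (seq (re z) n)) (ℚₚ.0≤∣p∣ (seq (im z) n))

‖+‖ : ∀ z w n → ‖ z + w ‖ n ℚ.≤ ‖ z ‖ n ℚ.+ ‖ w ‖ n
‖+‖ z w n = ≡.subst (‖ z + w ‖ n ℚ.≤_)
  (solve 4 (λ a b c d → (a :+ c) :+ (b :+ d) := (a :+ b) :+ (c :+ d)) ≡.refl
    ℚ.∣ seq (re z) n ∣ ℚ.∣ seq (im z) n ∣ ℚ.∣ seq (re w) n ∣ ℚ.∣ seq (im w) n ∣)
  (ℚₚ.+-mono-≤ (ℚₚ.∣p+q∣≤∣p∣+∣q∣ (seq (re z) n) (seq (re w) n))
               (ℚₚ.∣p+q∣≤∣p∣+∣q∣ (seq (im z) n) (seq (im w) n)))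
  where open ℚ-solver

‖-‖ : ∀ z n → ‖ - z ‖ n ≡ ‖ z ‖ n
‖-‖ z n = ≡.cong₂ ℚ._+_ (ℚₚ.∣-p∣≡∣p∣ (seq (re z) n)) (ℚₚ.∣-p∣≡∣p∣ (seq (im z) n))

‖*‖ : ∀ z w n → ‖ z * w ‖ n ℚ.≤ ‖ z ‖ n ℚ.* ‖ w ‖ n
‖*‖ z w n = begin
  ℚ.∣ a ℚ.* c ℚ.+ ℚ.- (b ℚ.* d) ∣ ℚ.+ ℚ.∣ a ℚ.* d ℚ.+ b ℚ.* c ∣
    ≤⟨ ℚₚ.+-mono-≤ (ℚₚ.∣p-q∣≤∣p∣+∣q∣ (a ℚ.* c) (b ℚ.* d)) (ℚₚ.∣p+q∣≤∣p∣+∣q∣ (a ℚ.* d) (b ℚ.* c)) ⟩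
  (ℚ.∣ a ℚ.* c ∣ ℚ.+ ℚ.∣ b ℚ.* d ∣) ℚ.+ (ℚ.∣ a ℚ.* d ∣ ℚ.+ ℚ.∣ b ℚ.* c ∣)
    ≡⟨ ≡.cong₂ ℚ._+_ (≡.cong₂ ℚ._+_ (ℚₚ.∣p*q∣≡∣p∣*∣q∣ a c) (ℚₚ.∣p*q∣≡∣p∣*∣q∣ b d))
                     (≡.cong₂ ℚ._+_ (ℚₚ.∣p*q∣≡∣p∣*∣q∣ a d) (ℚₚ.∣p*q∣≡∣p∣*∣q∣ b c)) ⟩
  (ℚ.∣ a ∣ ℚ.* ℚ.∣ c ∣ ℚ.+ ℚ.∣ b ∣ ℚ.* ℚ.∣ d ∣) ℚ.+ (ℚ.∣ a ∣ ℚ.* ℚ.∣ d ∣ ℚ.+ ℚ.∣ b ∣ ℚ.* ℚ.∣ c ∣)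
    ≡⟨ solve 4 (λ a b c d → (a :* c :+ b :* d) :+ (a :* d :+ b :* c) := (a :+ b) :* (c :+ d)) ≡.refl
         ℚ.∣ a ∣ ℚ.∣ b ∣ ℚ.∣ c ∣ ℚ.∣ d ∣ ⟩
  (ℚ.∣ a ∣ ℚ.+ ℚ.∣ b ∣) ℚ.* (ℚ.∣ c ∣ ℚ.+ ℚ.∣ d ∣) ∎
  where
  open ℚₚ.≤-Reasoning
  open ℚ-solver
  a = seq (re z) n
  b = seq (im z) n
  c = seq (re w) n
  d = seq (im w) n

infix 4 _≺_

-- The gap below B makes the relation invariant under ≈.
record _≺_ (z : ℂ) (B : ℚ) : Set where
  constructor mk≺
  field
    bound : ℚ
    bound<B : bound ℚ.< B
    eventually-bounded : Eventually (λ n → ‖ z ‖ n ℚ.≤ bound)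

≺⇒0< : ∀ {z B} → z ≺ B → 0ℚ ℚ.< B
≺⇒0< {z} (mk≺ b b<B (M , h)) = ℚₚ.≤-<-trans (ℚₚ.≤-trans (0≤‖ z ‖ M) (h M ℕₚ.≤-refl)) b<B

≺-mono : ∀ {z B C} → B ℚ.≤ C → z ≺ B → z ≺ C
≺-mono B≤C (mk≺ b b<B h) = mk≺ b (ℚₚ.<-≤-trans b<B B≤C) h

-- An intermediate `c` divides the gap: the distance from `z` to `w` may use up `c ℚ.- b`, half of
-- it in each coordinate, and `c<B` is the gap that remains.
≺-resp-≈ : ∀ {z w B} → z ≈ w → z ≺ B → w ≺ B
≺-resp-≈ {z} {w} {B} (p , q) (mk≺ b b<B h) with ℚₚ.<-dense b<B
... | c , b<c , c<B with halve {c ℚ.- b} (≡.subst (ℚ._< c ℚ.- b) (ℚₚ.+-inverseʳ b) (ℚₚ.+-monoˡ-< (ℚ.- b) b<c))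
... | δ , δ>0 , δ+δ≡c-b = mk≺ c c<B
  (eventually-map₂ (λ n zn (rn , in′) → begin
      ‖ w ‖ n
        ≤⟨ ℚₚ.+-mono-≤ (triangle (seq (re z) n) (seq (re w) n)) (triangle (seq (im z) n) (seq (im w) n)) ⟩
      (ℚ.∣ seq (re z) n ∣ ℚ.+ ℚ.∣ seq (re z) n ℚ.- seq (re w) n ∣)
        ℚ.+ (ℚ.∣ seq (im z) n ∣ ℚ.+ ℚ.∣ seq (im z) n ℚ.- seq (im w) n ∣)
        ≤⟨ ℚₚ.+-mono-≤ (ℚₚ.+-monoʳ-≤ ℚ.∣ seq (re z) n ∣ (ℚₚ.<⇒≤ rn))
                       (ℚₚ.+-monoʳ-≤ ℚ.∣ seq (im z) n ∣ (ℚₚ.<⇒≤ in′)) ⟩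
      (ℚ.∣ seq (re z) n ∣ ℚ.+ δ) ℚ.+ (ℚ.∣ seq (im z) n ∣ ℚ.+ δ)
        ≡⟨ solve 3 (λ a b d → (a :+ d) :+ (b :+ d) := (a :+ b) :+ (d :+ d)) ≡.refl
             ℚ.∣ seq (re z) n ∣ ℚ.∣ seq (im z) n ∣ δ ⟩
      ‖ z ‖ n ℚ.+ (δ ℚ.+ δ)
        ≤⟨ ℚₚ.+-mono-≤ zn (ℚₚ.≤-reflexive δ+δ≡c-b) ⟩
      b ℚ.+ (c ℚ.- b)
        ≡⟨ solve 2 (λ b c → b :+ (c :- b) := c) ≡.refl b c ⟩
      c ∎)
    h (eventually-× (eventually-close p δ δ>0) (eventually-close q δ δ>0)))
  where
  open ℚₚ.≤-Reasoning
  open ℚ-solver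
  triangle : ∀ x y → ℚ.∣ y ∣ ℚ.≤ ℚ.∣ x ∣ ℚ.+ ℚ.∣ x ℚ.- y ∣
  triangle x y = ≡.subst (ℚ._≤ ℚ.∣ x ∣ ℚ.+ ℚ.∣ x ℚ.- y ∣)
    (≡.cong ℚ.∣_∣ (solve 2 (λ x y → x :- (x :- y) := y) ≡.refl x y)) (ℚₚ.∣p-q∣≤∣p∣+∣q∣ x (x ℚ.- y))

≺-+ : ∀ {z w B C} → z ≺ B → w ≺ C → z + w ≺ B ℚ.+ C
≺-+ {z} {w} (mk≺ b b<B h) (mk≺ c c<C k) = mk≺ (b ℚ.+ c) (ℚₚ.+-mono-< b<B c<C)
  (eventually-map₂ (λ n p q → ℚₚ.≤-trans (‖+‖ z w n) (ℚₚ.+-mono-≤ p q)) h k)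

≺-neg : ∀ {z B} → z ≺ B → - z ≺ B
≺-neg {z} (mk≺ b b<B h) = mk≺ b b<B
  (eventually-map (λ n → ≡.subst (ℚ._≤ b) (≡.sym (‖-‖ z n))) h)

≺-- : ∀ {z w B C} → z ≺ B → w ≺ C → z - w ≺ B ℚ.+ C
≺-- p q = ≺-+ p (≺-neg q)

≺-* : ∀ {z w B C} → z ≺ B → w ≺ C → z * w ≺ B ℚ.* C
≺-* {z} {w} {B} {C} z≺B@(mk≺ b b<B (M , h)) (mk≺ c c<C (M′ , k)) = mk≺ (b ℚ.* c)
  (ℚₚ.≤-<-trans (ℚₚ.*-monoʳ-≤-nonNeg c {{ℚ.nonNegative c≥0}} (ℚₚ.<⇒≤ b<B))
                (*-monoˡ-< (≺⇒0< z≺B) c<C))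
  (eventually-map₂ (λ n p q → ℚₚ.≤-trans (‖*‖ z w n) (*-mono-≤ (0≤‖ w ‖ n) b≥0 p q)) (M , h) (M′ , k))
  where
  b≥0 = ℚₚ.≤-trans (0≤‖ z ‖ M) (h M ℕₚ.≤-refl)
  c≥0 = ℚₚ.≤-trans (0≤‖ w ‖ M′) (k M′ ℕₚ.≤-refl)

≺-κ : ∀ {r B} → ℚ.∣ r ∣ ℚ.< B → κ r ≺ B
≺-κ {r} ∣r∣<B = mk≺ ℚ.∣ r ∣ ∣r∣<B (always λ n → ℚₚ.≤-reflexive (ℚₚ.+-identityʳ ℚ.∣ r ∣))

≺-0# : ∀ {B} → 0ℚ ℚ.< B → 0# ≺ B
≺-0# = ≺-κ

p<p+1 : ∀ p → p ℚ.< p ℚ.+ 1ℚ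
p<p+1 p = ≡.subst (ℚ._< p ℚ.+ 1ℚ) (ℚₚ.+-identityʳ p) (ℚₚ.+-monoʳ-< p (ℚₚ.positive⁻¹ 1ℚ))

≺-exists : ∀ z → ∃[ B ] z ≺ B
≺-exists z =
  let B , _ , h = seq-bounded (re z)
      C , _ , k = seq-bounded (im z)
  in (B ℚ.+ C) ℚ.+ 1ℚ
    , mk≺ (B ℚ.+ C) (p<p+1 (B ℚ.+ C)) (eventually-map₂ (λ n p q → ℚₚ.+-mono-≤ p q) h k)

≺-small⇒≈0 : ∀ {z} → (∀ ε → 0ℚ ℚ.< ε → z ≺ ε) → z ≈ 0#
≺-small⇒≈0 {z} small =
    mk≈ (λ ε ε>0 → let mk≺ b b<ε h = small ε ε>0 in
      eventually-map (λ n p → ℚₚ.≤-<-trans (ℚₚ.≤-trans (ℚₚ.≤-trans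
        (ℚₚ.≤-reflexive (≡.cong ℚ.∣_∣ (ℚₚ.+-identityʳ (seq (re z) n))))
        (p≤p+q (ℚₚ.0≤∣p∣ (seq (im z) n)))) p) b<ε) h)
  , mk≈ (λ ε ε>0 → let mk≺ b b<ε h = small ε ε>0 in
      eventually-map (λ n p → ℚₚ.≤-<-trans (ℚₚ.≤-trans (ℚₚ.≤-trans
        (ℚₚ.≤-reflexive (≡.cong ℚ.∣_∣ (ℚₚ.+-identityʳ (seq (im z) n))))
        (q≤p+q (ℚₚ.0≤∣p∣ (seq (re z) n)))) p) b<ε) h)

min-pos : ∀ {a b} → 0ℚ ℚ.< a → 0ℚ ℚ.< b → ∃[ x ] 0ℚ ℚ.< x × x ℚ.< a × x ℚ.< b
min-pos {a} {b} a>0 b>0 with ℚₚ.≤-total a b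
... | inj₁ a≤b = let x , x>0 , x<a = ℚₚ.<-dense a>0 in x , x>0 , x<a , ℚₚ.<-≤-trans x<a a≤b
... | inj₂ b≤a = let x , x>0 , x<b = ℚₚ.<-dense b>0 in x , x>0 , ℚₚ.<-≤-trans x<b b≤a , x<b

-- Estimates as `x` tends to 0 from the right

Near0 : (ℚ → Set) → Set
Near0 P = ∃[ X ] 0ℚ ℚ.< X × (∀ x → 0ℚ ℚ.< x → x ℚ.< X → P x)

-- This takes the place of uniqueness of limits: `z` does not depend on `x`.
≺-linear⇒≈0 : ∀ {z} K → Near0 (λ x → z ≺ K ℚ.* x) → z ≈ 0#
≺-linear⇒≈0 {z} K (X , X>0 , h) = ≺-small⇒≈0 λ ε ε>0 →
  -- No sign of `K` is given, so it is raised to a positive number by which `ε` can be divided.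
  let K′ = K ℚ.⊔ 1ℚ
      K′>0 = ℚₚ.<-≤-trans (ℚₚ.positive⁻¹ 1ℚ) (ℚₚ.p≤q⊔p K 1ℚ)
      δ , δ>0 , Kδ≡ε = quotient K′>0 ε>0
      x , x>0 , x<X , x<δ = min-pos X>0 δ>0
  in ≺-mono (ℚₚ.≤-trans (ℚₚ.*-monoʳ-≤-nonNeg x {{ℚ.nonNegative (ℚₚ.<⇒≤ x>0)}} (ℚₚ.p≤p⊔q K 1ℚ))
              (ℚₚ.≤-trans (ℚₚ.<⇒≤ (*-monoˡ-< K′>0 x<δ)) (ℚₚ.≤-reflexive Kδ≡ε)))
            (h x x>0 x<X)

-- Squared moduli and the ℓ¹ norm

square-nonNeg : ∀ p → 0ℚ ℚ.≤ p ℚ.* p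
square-nonNeg p with ℚₚ.≤-total 0ℚ p
... | inj₁ p≥0 = *-nonNeg p≥0 p≥0
... | inj₂ p≤0 = ℚₚ.nonNegative⁻¹ (p ℚ.* p)
  {{ℚₚ.nonPos*nonPos⇒nonPos p {{ℚ.nonPositive p≤0}} p {{ℚ.nonPositive p≤0}}}}

square-cancel-≤ : ∀ {p q} → 0ℚ ℚ.≤ q → p ℚ.* p ℚ.≤ q ℚ.* q → ℚ.∣ p ∣ ℚ.≤ q
square-cancel-≤ {p} {q} q≥0 pp≤qq with ℚ.∣ p ∣ ℚₚ.≤? q
... | yes ∣p∣≤q = ∣p∣≤q
... | no ∣p∣≰q = contradiction (ℚₚ.<-≤-trans qq<pp pp≤qq) (ℚₚ.<-irrefl ≡.refl)
  where
  q<∣p∣ = ℚₚ.≰⇒> ∣p∣≰q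
  square-abs : ℚ.∣ p ∣ ℚ.* ℚ.∣ p ∣ ≡ p ℚ.* p
  square-abs = ≡.trans (≡.sym (ℚₚ.∣p*q∣≡∣p∣*∣q∣ p p)) (ℚₚ.0≤p⇒∣p∣≡p (square-nonNeg p))
  qq<pp : q ℚ.* q ℚ.< p ℚ.* p
  qq<pp = ≡.subst (q ℚ.* q ℚ.<_) square-abs
    (ℚₚ.≤-<-trans (ℚₚ.*-monoˡ-≤-nonNeg q {{ℚ.nonNegative q≥0}} (ℚₚ.<⇒≤ q<∣p∣))
                  (*-monoʳ-< (ℚₚ.≤-<-trans q≥0 q<∣p∣) q<∣p∣))

-- Each coordinate is at most `ε`, which gives `ε ℚ.+ ε` for the ℓ¹ norm; the third `ε` is the gap
-- that `≺` demands.
∣∣²<⇒≺ : ∀ {z ε} → 0ℚ ℚ.< ε → ∣ z ∣² <ʳ ofℚ (ε ℚ.* ε) → z ≺ (ε ℚ.+ ε) ℚ.+ ε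
∣∣²<⇒≺ {z} {ε} ε>0 (mk< g g>0 h) = mk≺ (ε ℚ.+ ε)
  (≡.subst (ℚ._< (ε ℚ.+ ε) ℚ.+ ε) (ℚₚ.+-identityʳ (ε ℚ.+ ε)) (ℚₚ.+-monoʳ-< (ε ℚ.+ ε) ε>0))
  (eventually-map (λ n p →
      let a = seq (re z) n
          b = seq (im z) n
          aa+bb≤εε = ℚₚ.≤-trans (p≤p+q (ℚₚ.<⇒≤ g>0)) (ℚₚ.<⇒≤ p)
      in ℚₚ.+-mono-≤
        (square-cancel-≤ {a} (ℚₚ.<⇒≤ ε>0) (ℚₚ.≤-trans (p≤p+q {a ℚ.* a} {b ℚ.* b} (square-nonNeg b)) aa+bb≤εε))
        (square-cancel-≤ {b} (ℚₚ.<⇒≤ ε>0) (ℚₚ.≤-trans (q≤p+q {a ℚ.* a} {b ℚ.* b} (square-nonNeg a)) aa+bb≤εε)))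
    h)

-- Half of `q ℚ.- p` absorbs the deviation of `x` from `p`, the other half is the new gap.
<ʳ-respˡ-≈ʳ : ∀ {x p q} → x ≈ʳ ofℚ p → p ℚ.< q → x <ʳ ofℚ q
<ʳ-respˡ-≈ʳ {x} {p} {q} x≈p p<q =
  let δ , δ>0 , δ+δ≡q-p = halve {q ℚ.- p} (≡.subst (ℚ._< q ℚ.- p) (ℚₚ.+-inverseʳ p) (ℚₚ.+-monoˡ-< (ℚ.- p) p<q))
  in mk< δ δ>0 (eventually-map (λ n h → begin-strict
      seq x n ℚ.+ δ
        ≡⟨ solve 3 (λ x p d → x :+ d := p :+ ((x :- p) :+ d)) ≡.refl (seq x n) p δ ⟩
      p ℚ.+ ((seq x n ℚ.- p) ℚ.+ δ)
        <⟨ ℚₚ.+-monoʳ-< p (ℚₚ.+-monoˡ-< δ (ℚₚ.≤-<-trans (p≤∣p∣ (seq x n ℚ.- p)) h)) ⟩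
      p ℚ.+ (δ ℚ.+ δ)
        ≡⟨ ≡.cong (p ℚ.+_) δ+δ≡q-p ⟩
      p ℚ.+ (q ℚ.- p)
        ≡⟨ solve 2 (λ p q → p :+ (q :- p) := q) ≡.refl p q ⟩
      q ∎)
    (eventually-close x≈p δ δ>0))
  where
  open ℚₚ.≤-Reasoning
  open ℚ-solver

-- A condition on every approximation, hence not invariant under `≈`. The numbers concerned are
-- built from nonnegative rationals and squared moduli by sums and products, so it holds exactly and
-- signs are available at each index.
record NonNegReal (z : ℂ) : Set where
  constructor mkNonNegReal
  field
    re≥0 : ∀ n → 0ℚ ℚ.≤ seq (re z) n
    im≡0 : ∀ n → seq (im z) n ≡ 0ℚ

open NonNegReal

nonNegReal-0# : NonNegReal 0#
nonNegReal-0# = mkNonNegReal (λ _ → ℚₚ.≤-refl) (λ _ → ≡.refl)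

nonNegReal-1# : NonNegReal 1#
nonNegReal-1# = mkNonNegReal (λ _ → ℚₚ.nonNegative⁻¹ 1ℚ) (λ _ → ≡.refl)

nonNegReal-+ : ∀ {z w} → NonNegReal z → NonNegReal w → NonNegReal (z + w)
nonNegReal-+ p q = mkNonNegReal (λ n → +-nonNeg (re≥0 p n) (re≥0 q n))
  (λ n → ≡.cong₂ ℚ._+_ (im≡0 p n) (im≡0 q n))

nonNegReal-* : ∀ {z w} → NonNegReal z → NonNegReal w → NonNegReal (z * w)
nonNegReal-* {z} {w} p q = mkNonNegReal
  (λ n → ≡.subst (0ℚ ℚ.≤_) (≡.sym (real-part n)) (*-nonNeg (re≥0 p n) (re≥0 q n)))
  (λ n → ≡.trans (≡.cong₂ (λ b d → seq (re z) n ℚ.* d ℚ.+ b ℚ.* seq (re w) n) (im≡0 p n) (im≡0 q n))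
    (solve 2 (λ a c → a :* con 0ℚ :+ con 0ℚ :* c := con 0ℚ) ≡.refl (seq (re z) n) (seq (re w) n)))
  where
  open ℚ-solver
  real-part : ∀ n → seq (re (z * w)) n ≡ seq (re z) n ℚ.* seq (re w) n
  real-part n = ≡.trans
    (≡.cong₂ (λ b d → seq (re z) n ℚ.* seq (re w) n ℚ.+ ℚ.- (b ℚ.* d)) (im≡0 p n) (im≡0 q n))
    (ℚₚ.+-identityʳ _)

nonNegReal-κ : ∀ {r} → 0ℚ ℚ.≤ r → NonNegReal (κ r)
nonNegReal-κ r≥0 = mkNonNegReal (λ _ → r≥0) (λ _ → ≡.refl)

nonNegReal-∣∣² : ∀ z → NonNegReal (ι ∣ z ∣²)
nonNegReal-∣∣² z = mkNonNegReal
  (λ n → +-nonNeg (square-nonNeg (seq (re z) n)) (square-nonNeg (seq (im z) n))) (λ _ → ≡.refl)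

1≤1+p : ∀ {p} → 0ℚ ℚ.≤ p → 1ℚ ℚ.≤ 1ℚ ℚ.+ p
1≤1+p = p≤p+q

1+nonNegReal≉0# : ∀ {u} → NonNegReal u → ¬ (1# + u ≈ 0#)
1+nonNegReal≉0# {u} u≥0 (p , _) with eventually-close p 1ℚ (ℚₚ.positive⁻¹ 1ℚ)
... | M , h = ℚₚ.<-irrefl ≡.refl (ℚₚ.≤-<-trans
  (ℚₚ.≤-trans (1≤1+p (re≥0 u≥0 M)) (≡.subst (1ℚ ℚ.+ seq (re u) M ℚ.≤_)
    (≡.cong ℚ.∣_∣ (≡.sym (ℚₚ.+-identityʳ (1ℚ ℚ.+ seq (re u) M)))) (p≤∣p∣ (1ℚ ℚ.+ seq (re u) M))))
  (h M ℕₚ.≤-refl))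

-- A substitute for division: multiplication by a real number that is at least 1 does not decrease
-- the ℓ¹ norm of any approximation.
≺-cancel-1+nonNegReal : ∀ {u z B} → NonNegReal u → (1# + u) * z ≺ B → z ≺ B
≺-cancel-1+nonNegReal {u} {z} {B} u≥0 (mk≺ b b<B h) = mk≺ b b<B
  (eventually-map (λ n → ℚₚ.≤-trans (ℚₚ.≤-trans (‖z‖≤ n) (ℚₚ.≤-reflexive (≡.sym (norm n))))) h)
  where
  open ℚ-solver
  scaled : ∀ a x → 0ℚ ℚ.≤ a → ℚ.∣ (1ℚ ℚ.+ a) ℚ.* x ∣ ≡ (1ℚ ℚ.+ a) ℚ.* ℚ.∣ x ∣
  scaled a x a≥0 = ≡.trans (ℚₚ.∣p*q∣≡∣p∣*∣q∣ (1ℚ ℚ.+ a) x)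
    (≡.cong (ℚ._* ℚ.∣ x ∣) (ℚₚ.0≤p⇒∣p∣≡p (+-nonNeg (ℚₚ.nonNegative⁻¹ 1ℚ) a≥0)))

  norm : ∀ n → ‖ (1# + u) * z ‖ n ≡ (1ℚ ℚ.+ seq (re u) n) ℚ.* ‖ z ‖ n
  norm n = begin
    ℚ.∣ (1ℚ ℚ.+ a) ℚ.* f ℚ.+ ℚ.- ((0ℚ ℚ.+ b′) ℚ.* g) ∣ ℚ.+ ℚ.∣ (1ℚ ℚ.+ a) ℚ.* g ℚ.+ (0ℚ ℚ.+ b′) ℚ.* f ∣
      ≡⟨ ≡.cong (λ b → ℚ.∣ (1ℚ ℚ.+ a) ℚ.* f ℚ.+ ℚ.- ((0ℚ ℚ.+ b) ℚ.* g) ∣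
                       ℚ.+ ℚ.∣ (1ℚ ℚ.+ a) ℚ.* g ℚ.+ (0ℚ ℚ.+ b) ℚ.* f ∣) (im≡0 u≥0 n) ⟩
    ℚ.∣ (1ℚ ℚ.+ a) ℚ.* f ℚ.+ ℚ.- (0ℚ ℚ.* g) ∣ ℚ.+ ℚ.∣ (1ℚ ℚ.+ a) ℚ.* g ℚ.+ 0ℚ ℚ.* f ∣
      ≡⟨ ≡.cong₂ (λ v w → ℚ.∣ v ∣ ℚ.+ ℚ.∣ w ∣)
           (solve 3 (λ a f g → a :* f :+ :- (con 0ℚ :* g) := a :* f) ≡.refl (1ℚ ℚ.+ a) f g)
           (solve 3 (λ a f g → a :* g :+ con 0ℚ :* f := a :* g) ≡.refl (1ℚ ℚ.+ a) f g) ⟩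
    ℚ.∣ (1ℚ ℚ.+ a) ℚ.* f ∣ ℚ.+ ℚ.∣ (1ℚ ℚ.+ a) ℚ.* g ∣
      ≡⟨ ≡.cong₂ ℚ._+_ (scaled a f (re≥0 u≥0 n)) (scaled a g (re≥0 u≥0 n)) ⟩
    (1ℚ ℚ.+ a) ℚ.* ℚ.∣ f ∣ ℚ.+ (1ℚ ℚ.+ a) ℚ.* ℚ.∣ g ∣
      ≡⟨ ≡.sym (ℚₚ.*-distribˡ-+ (1ℚ ℚ.+ a) ℚ.∣ f ∣ ℚ.∣ g ∣) ⟩
    (1ℚ ℚ.+ a) ℚ.* (ℚ.∣ f ∣ ℚ.+ ℚ.∣ g ∣) ∎
    where
    open ≡.≡-Reasoning
    a = seq (re u) n
    b′ = seq (im u) n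
    f = seq (re z) n
    g = seq (im z) n

  ‖z‖≤ : ∀ n → ‖ z ‖ n ℚ.≤ (1ℚ ℚ.+ seq (re u) n) ℚ.* ‖ z ‖ n
  ‖z‖≤ n = ≡.subst (ℚ._≤ (1ℚ ℚ.+ seq (re u) n) ℚ.* ‖ z ‖ n) (ℚₚ.*-identityˡ (‖ z ‖ n))
    (ℚₚ.*-monoʳ-≤-nonNeg (‖ z ‖ n) {{ℚ.nonNegative (0≤‖ z ‖ n)}} (1≤1+p (re≥0 u≥0 n)))

-- Absence of zero divisors

-- Comparing the rational |yₘ| with δ, for m with |yₙ - yₘ| < δ / 2 from m on, decides whether y is
-- small or bounded away from 0; the latter forces x ≈ 0.
*ʳ-≈0ʳ⇒ : ∀ {x y} → x *ʳ y ≈ʳ ofℚ 0ℚ → ¬ (x ≈ʳ ofℚ 0ℚ) → y ≈ʳ ofℚ 0ℚ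
*ʳ-≈0ʳ⇒ {x} {y} xy≈0 x≉0 = mk≈ close
  where
  open ℚₚ.≤-Reasoning
  open ℚ-solver

  ∣p-0∣ : ∀ p → ℚ.∣ p ℚ.- 0ℚ ∣ ≡ ℚ.∣ p ∣
  ∣p-0∣ p = ≡.cong ℚ.∣_∣ (ℚₚ.+-identityʳ p)

  x≈0 : ∀ {δ M} → 0ℚ ℚ.< δ → (∀ n → M ℕ.≤ n → δ ℚ.≤ ℚ.∣ seq y n ∣) → x ≈ʳ ofℚ 0ℚ
  x≈0 {δ} {M} δ>0 δ≤y = mk≈ λ η η>0 →
    eventually-map₂ (λ n xyn δ≤yn → ≡.subst (ℚ._< η) (≡.sym (∣p-0∣ (seq x n)))
      (ℚₚ.*-cancelʳ-<-nonNeg δ {{ℚ.nonNegative (ℚₚ.<⇒≤ δ>0)}} (begin-strict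
        ℚ.∣ seq x n ∣ ℚ.* δ
          ≤⟨ ℚₚ.*-monoˡ-≤-nonNeg ℚ.∣ seq x n ∣ {{ℚₚ.∣-∣-nonNeg (seq x n)}} δ≤yn ⟩
        ℚ.∣ seq x n ∣ ℚ.* ℚ.∣ seq y n ∣
          ≡⟨ ≡.sym (≡.trans (∣p-0∣ (seq x n ℚ.* seq y n)) (ℚₚ.∣p*q∣≡∣p∣*∣q∣ (seq x n) (seq y n))) ⟩
        ℚ.∣ seq x n ℚ.* seq y n ℚ.- 0ℚ ∣
          <⟨ xyn ⟩
        η ℚ.* δ ∎)))
      (eventually-close xy≈0 (η ℚ.* δ) (*-pos η>0 δ>0)) (M , δ≤y)

  triangle : ∀ a b → ℚ.∣ a ∣ ℚ.≤ ℚ.∣ a ℚ.- b ∣ ℚ.+ ℚ.∣ b ∣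
  triangle a b = ≡.subst (ℚ._≤ ℚ.∣ a ℚ.- b ∣ ℚ.+ ℚ.∣ b ∣)
    (≡.cong ℚ.∣_∣ (solve 2 (λ a b → (a :- b) :+ b := a) ≡.refl a b)) (ℚₚ.∣p+q∣≤∣p∣+∣q∣ (a ℚ.- b) b)

  close : ∀ ε → 0ℚ ℚ.< ε → Eventually (λ n → ℚ.∣ seq y n ℚ.- 0ℚ ∣ ℚ.< ε)
  close ε ε>0 with halve ε>0
  ... | δ , δ>0 , δ+δ≡ε with halve δ>0
  ... | δ′ , δ′>0 , δ′+δ′≡δ with cauchy y δ′ δ′>0
  ... | M , h with ℚ.∣ seq y M ∣ ℚₚ.<? δ
  ... | yes yM<δ = M , λ n M≤n → begin-strict
    ℚ.∣ seq y n ℚ.- 0ℚ ∣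
      ≡⟨ ∣p-0∣ (seq y n) ⟩
    ℚ.∣ seq y n ∣
      ≤⟨ triangle (seq y n) (seq y M) ⟩
    ℚ.∣ seq y n ℚ.- seq y M ∣ ℚ.+ ℚ.∣ seq y M ∣
      <⟨ ℚₚ.+-mono-< (ℚₚ.<-≤-trans (h n M M≤n ℕₚ.≤-refl)
           (ℚₚ.≤-trans (p≤p+q (ℚₚ.<⇒≤ δ′>0)) (ℚₚ.≤-reflexive δ′+δ′≡δ))) yM<δ ⟩
    δ ℚ.+ δ
      ≡⟨ δ+δ≡ε ⟩
    ε ∎
  ... | no yM≮δ = contradiction (x≈0 {δ′} {M} δ′>0 (λ n M≤n → ℚₚ.≮⇒≥ λ yn<δ′ → yM≮δ (begin-strict
    ℚ.∣ seq y M ∣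
      ≤⟨ triangle (seq y M) (seq y n) ⟩
    ℚ.∣ seq y M ℚ.- seq y n ∣ ℚ.+ ℚ.∣ seq y n ∣
      <⟨ ℚₚ.+-mono-< (h M n ℕₚ.≤-refl M≤n) yn<δ′ ⟩
    δ′ ℚ.+ δ′
      ≡⟨ δ′+δ′≡δ ⟩
    δ ∎))) x≉0

-- Complex conjugation

conj : ℂ → ℂ
conj z = re z +i (-ʳ im z)

conj-cong : ∀ {z w} → z ≈ w → conj z ≈ conj w
conj-cong (p , q) = p , -ʳ-cong q

conj-homo-+ : ∀ z w → conj (z + w) ≈ conj z + conj w
conj-homo-+ z w = pointwise (λ _ → ≡.refl) (λ n → ℚₚ.neg-distrib-+ (seq (im z) n) (seq (im w) n))

conj-homo-* : ∀ z w → conj (z * w) ≈ conj z * conj w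
conj-homo-* z w = pointwise
  (λ n → solve 4 (λ a b c d → a :* c :+ :- (b :* d) := a :* c :+ :- (:- b :* :- d)) ≡.refl
    (seq (re z) n) (seq (im z) n) (seq (re w) n) (seq (im w) n))
  (λ n → solve 4 (λ a b c d → :- (a :* d :+ b :* c) := a :* (:- d) :+ (:- b) :* c) ≡.refl
    (seq (re z) n) (seq (im z) n) (seq (re w) n) (seq (im w) n))
  where open ℚ-solver

conj-κ : ∀ r → conj (κ r) ≈ κ r
conj-κ r = pointwise (λ _ → ≡.refl) (λ _ → ≡.refl)

z*conj[z]≈∣z∣² : ∀ z → z * conj z ≈ ι ∣ z ∣²
z*conj[z]≈∣z∣² z = pointwise
  (λ n → solve 2 (λ a b → a :* a :+ :- (b :* (:- b)) := a :* a :+ b :* b) ≡.refl (seq (re z) n) (seq (im z) n))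
  (λ n → solve 2 (λ a b → a :* (:- b) :+ b :* a := con 0ℚ) ≡.refl (seq (re z) n) (seq (im z) n))
  where open ℚ-solver

∣∣²-cong : ∀ {z w} → z ≈ w → ∣ z ∣² ≈ʳ ∣ w ∣²
∣∣²-cong (p , q) = +ʳ-cong (*ʳ-cong p p) (*ʳ-cong q q)

∣z∣²≈0⇒z≈0 : ∀ {z} → ∣ z ∣² ≈ʳ ofℚ 0ℚ → z ≈ 0#
∣z∣²≈0⇒z≈0 {z} p = ≺-small⇒≈0 λ ε ε>0 →
  let δ , δ>0 , 3δ≡ε = quotient {1ℚ ℚ.+ 1ℚ ℚ.+ 1ℚ} (ℚₚ.positive⁻¹ (1ℚ ℚ.+ 1ℚ ℚ.+ 1ℚ)) ε>0
  in ≺-mono (ℚₚ.≤-reflexive (≡.trans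
       (solve 1 (λ d → d :+ d :+ d := (con 1ℚ :+ con 1ℚ :+ con 1ℚ) :* d) ≡.refl δ) 3δ≡ε))
     (∣∣²<⇒≺ δ>0 (<ʳ-respˡ-≈ʳ p (*-pos δ>0 δ>0)))
  where open ℚ-solver

*-≈0⇒ : ∀ {z w} → z * w ≈ 0# → ¬ (z ≈ 0#) → w ≈ 0#
*-≈0⇒ {z} {w} zw≈0 z≉0 =
    *ʳ-≈0ʳ⇒ (≈ʳ-trans (pointwiseʳ λ n → solve 3 (λ a x y → a :* x := a :* x :+ :- (con 0ℚ :* y)) ≡.refl
        (seq ∣ z ∣² n) (seq (re w) n) (seq (im w) n)) (_≈ᶜ_.re≈ ∣z∣²w≈0)) ∣z∣²≉0
  , *ʳ-≈0ʳ⇒ (≈ʳ-trans (pointwiseʳ λ n → solve 3 (λ a x y → a :* y := a :* y :+ con 0ℚ :* x) ≡.refl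
        (seq ∣ z ∣² n) (seq (re w) n) (seq (im w) n)) (_≈ᶜ_.im≈ ∣z∣²w≈0)) ∣z∣²≉0
  where
  open ℚ-solver
  ∣z∣²≉0 : ¬ (∣ z ∣² ≈ʳ ofℚ 0ℚ)
  ∣z∣²≉0 p = z≉0 (∣z∣²≈0⇒z≈0 p)
  ∣z∣²w≈0 : ι ∣ z ∣² * w ≈ 0#
  ∣z∣²w≈0 = begin
    ι ∣ z ∣² * w       ≈⟨ *-congʳ (z*conj[z]≈∣z∣² z) ⟨
    (z * conj z) * w   ≈⟨ *-congʳ (*-comm z (conj z)) ⟩
    (conj z * z) * w   ≈⟨ *-assoc (conj z) z w ⟩
    conj z * (z * w)   ≈⟨ *-congˡ zw≈0 ⟩
    conj z * 0#        ≈⟨ zeroʳ (conj z) ⟩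
    0#                 ∎
    where open import Relation.Binary.Reasoning.Setoid setoid

open import Algebra.Properties.Semiring.Sum semiring using (sum-cong-≋; ∑-distrib-+; *-distribˡ-sum)
open import Algebra.Properties.CommutativeSemiring.Exp (CommutativeRing.commutativeSemiring ℂ-commutativeRing)
  using (^-congˡ; ^-homo-*; ^-distrib-*)
open import Relation.Binary.Reasoning.Setoid setoid

x≈y⇒x-y≈0 : ∀ {x y} → x ≈ y → x - y ≈ 0#
x≈y⇒x-y≈0 {x} {y} x≈y = trans (+-congʳ x≈y) (solve 1 (λ y → y :- y := con 0ℚ) refl y)
  where open ℂ-solver

x-y≈0⇒x≈y : ∀ {x y} → x - y ≈ 0# → x ≈ y
x-y≈0⇒x≈y {x} {y} x-y≈0 = begin
  x             ≈⟨ solve 2 (λ x y → x := (x :- y) :+ y) refl x y ⟩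
  (x - y) + y   ≈⟨ +-congʳ x-y≈0 ⟩
  0# + y        ≈⟨ +-identityˡ y ⟩
  y             ∎
  where open ℂ-solver

-- Finite sums

∑<-cong : ∀ n {f g : ℕ → ℂ} → (∀ m → f m ≈ g m) → ∑< n f ≈ ∑< n g
∑<-cong n f≈g = sum-cong-≋ {n} λ i → f≈g (toℕ i)

∑<-distrib-+ : ∀ n (f g : ℕ → ℂ) → ∑< n (λ m → f m + g m) ≈ ∑< n f + ∑< n g
∑<-distrib-+ n f g = ∑-distrib-+ {n} (λ i → f (toℕ i)) (λ i → g (toℕ i))

*-distribˡ-∑< : ∀ n z (f : ℕ → ℂ) → z * ∑< n f ≈ ∑< n (λ m → z * f m)
*-distribˡ-∑< n z f = *-distribˡ-sum {n} z (λ i → f (toℕ i))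

∑<-0# : ∀ n → ∑< n (λ _ → 0#) ≈ 0#
∑<-0# zero    = refl
∑<-0# (suc n) = trans (+-identityˡ _) (∑<-0# n)

∑<-split : ∀ m n (f : ℕ → ℂ) → ∑< (m ℕ.+ n) f ≈ ∑< m f + ∑< n (λ k → f (m ℕ.+ k))
∑<-split zero    n f = sym (+-identityˡ _)
∑<-split (suc m) n f = trans (+-congˡ (∑<-split m n (f ∘ suc))) (sym (+-assoc _ _ _))

∑<-last : ∀ n (f : ℕ → ℂ) → ∑< (suc n) f ≈ ∑< n f + f n
∑<-last zero    f = +-comm (f 0) 0#
∑<-last (suc n) f = trans (+-congˡ (∑<-last n (f ∘ suc))) (sym (+-assoc _ _ _))

-- Horner's rule, the recursion behind all bounds on `fourier`.
fourier-suc : ∀ n a z → fourier (suc n) a z ≈ a 0 + z * fourier n (a ∘ suc) z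
fourier-suc n a z = +-cong (*-identityʳ (a 0)) (begin
  ∑< n (λ m → a (suc m) * (z * z ^ m))   ≈⟨ ∑<-cong n (λ m →
    solve 3 (λ a z w → a :* (z :* w) := z :* (a :* w)) refl (a (suc m)) z (z ^ m)) ⟩
  ∑< n (λ m → z * (a (suc m) * z ^ m))   ≈⟨ *-distribˡ-∑< n z (λ m → a (suc m) * z ^ m) ⟨
  z * fourier n (a ∘ suc) z              ∎)
  where open ℂ-solver

fourier-cong : ∀ n a {z w} → z ≈ w → fourier n a z ≈ fourier n a w
fourier-cong n a z≈w = ∑<-cong n λ m → *-congˡ {a m} (^-congˡ m z≈w)

-- Geometric sums

-- Defined through `fourier`, so that `fourier-cong` and `fourier-lipschitz` apply to it.
geom : ℕ → ℂ → ℂ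
geom n = fourier n (λ _ → 1#)

geom-suc : ∀ n z → geom (suc n) z ≈ 1# + z * geom n z
geom-suc n = fourier-suc n (λ _ → 1#)

geom-telescope : ∀ n z → (1# - z) * geom n z ≈ 1# - z ^ n
geom-telescope zero    z = trans (zeroʳ _) (sym (x≈y⇒x-y≈0 refl))
geom-telescope (suc n) z = begin
  (1# - z) * geom (suc n) z
    ≈⟨ *-congˡ (geom-suc n z) ⟩
  (1# - z) * (1# + z * geom n z)
    ≈⟨ solve 2 (λ z g → (con 1ℚ :- z) :* (con 1ℚ :+ z :* g) := (con 1ℚ :- z) :+ z :* ((con 1ℚ :- z) :* g))
         refl z (geom n z) ⟩
  (1# - z) + z * ((1# - z) * geom n z)
    ≈⟨ +-congˡ (*-congˡ (geom-telescope n z)) ⟩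
  (1# - z) + z * (1# - z ^ n)
    ≈⟨ solve 2 (λ z w → (con 1ℚ :- z) :+ z :* (con 1ℚ :- w) := con 1ℚ :- z :* w) refl z (z ^ n) ⟩
  1# - z * z ^ n ∎
  where open ℂ-solver

geom-nonNegReal : ∀ n {z} → NonNegReal z → NonNegReal (geom n z)
geom-nonNegReal n {z} z≥0 = helper n (λ m → nonNegReal-* nonNegReal-1# (power m))
  where
  power : ∀ m → NonNegReal (z ^ m)
  power zero    = nonNegReal-1#
  power (suc m) = nonNegReal-* z≥0 (power m)
  helper : ∀ n {f : ℕ → ℂ} → (∀ m → NonNegReal (f m)) → NonNegReal (∑< n f)
  helper zero    h = nonNegReal-0#
  helper (suc n) h = nonNegReal-+ (h 0) (helper n (h ∘ suc))

-- With n / 1 replaced by its normal form `mkℚ`, the sum in ℚ computes, and only a factor 1 in the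
-- numerator has to be removed.
suc/1 : ∀ n → (+ suc n) ℚ./ 1 ≡ 1ℚ ℚ.+ (+ n) ℚ./ 1
suc/1 n = ≡.sym (≡.trans (≡.cong (1ℚ ℚ.+_) (ℚₚ.↥p/↧p≡p (mkℚ (+ n) 0 (Coprimality.sym (Coprimality.1-coprimeTo n)))))
  (≡.cong (ℚ._/ 1) (≡.cong (λ k → + 1 ℤ.+ k) (ℤₚ.*-identityʳ (+ n)))))

ofℕ-suc : ∀ n → ofℕ (suc n) ≈ 1# + ofℕ n
ofℕ-suc n = trans (κ-cong (suc/1 n)) (κ-homo-+ 1ℚ ((+ n) ℚ./ 1))

geom-1# : ∀ n → geom n 1# ≈ ofℕ n
geom-1# zero    = refl
geom-1# (suc n) = begin
  geom (suc n) 1#       ≈⟨ geom-suc n 1# ⟩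
  1# + 1# * geom n 1#   ≈⟨ +-congˡ (trans (*-identityˡ _) (geom-1# n)) ⟩
  1# + ofℕ n            ≈⟨ ofℕ-suc n ⟨
  ofℕ (suc n)           ∎

-- Roots of unity

1^n≈1 : ∀ n → 1# ^ n ≈ 1#
1^n≈1 zero    = refl
1^n≈1 (suc n) = trans (*-identityˡ _) (1^n≈1 n)

conj-homo-^ : ∀ z n → conj (z ^ n) ≈ conj z ^ n
conj-homo-^ z zero    = conj-κ 1ℚ
conj-homo-^ z (suc n) = trans (conj-homo-* z (z ^ n)) (*-congˡ {conj z} (conj-homo-^ z n))

rootOfUnity-* : ∀ {n z w} → RootOfUnity n z → RootOfUnity n w → RootOfUnity n (z * w)
rootOfUnity-* {n} {z} {w} zⁿ≈1 wⁿ≈1 = trans (^-distrib-* z w n) (trans (*-cong zⁿ≈1 wⁿ≈1) (*-identityˡ 1#))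

rootOfUnity-conj : ∀ {n z} → RootOfUnity n z → RootOfUnity n (conj z)
rootOfUnity-conj {n} {z} zⁿ≈1 = trans (sym (conj-homo-^ z n)) (trans (conj-cong zⁿ≈1) (conj-κ 1ℚ))

geom-root≈0 : ∀ {n z} → RootOfUnity n z → ¬ (z ≈ 1#) → geom n z ≈ 0#
geom-root≈0 {n} {z} zⁿ≈1 z≉1 = *-≈0⇒ {1# - z}
  (trans (geom-telescope n z) (x≈y⇒x-y≈0 (sym zⁿ≈1)))
  (λ 1-z≈0 → z≉1 (sym (x-y≈0⇒x≈y 1-z≈0)))

-- With X = |ω|², the product (1 - X)(1 + X + ... ) equals 1 - X^n = 0, and the second factor is at
-- least 1 because X ≥ 0. Hence X = 1, without extracting roots.
∣ω∣²≈1 : ∀ {n ω} .{{_ : NonZero n}} → RootOfUnity n ω → ∣ ω ∣² ≈ʳ ofℚ 1ℚ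
∣ω∣²≈1 {suc n} {ω} ωⁿ≈1 = _≈ᶜ_.re≈ (sym (x-y≈0⇒x≈y (*-≈0⇒ {geom (suc n) X}
  (trans (*-comm _ _) (trans (geom-telescope (suc n) X) (x≈y⇒x-y≈0 (sym Xⁿ≈1))))
  (λ g≈0 → 1+nonNegReal≉0# (nonNegReal-* X≥0 (geom-nonNegReal n X≥0)) (trans (sym (geom-suc n X)) g≈0)))))
  where
  X = ι ∣ ω ∣²
  X≥0 = nonNegReal-∣∣² ω
  Xⁿ≈1 : X ^ suc n ≈ 1#
  Xⁿ≈1 = trans (^-congˡ (suc n) (sym (z*conj[z]≈∣z∣² ω)))
    (rootOfUnity-* {suc n} ωⁿ≈1 (rootOfUnity-conj {suc n} ωⁿ≈1))

ω*conj[ω]≈1 : ∀ {n ω} .{{_ : NonZero n}} → RootOfUnity n ω → ω * conj ω ≈ 1#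
ω*conj[ω]≈1 {n} {ω} ωⁿ≈1 = trans (z*conj[z]≈∣z∣² ω) (∣ω∣²≈1 {n} ωⁿ≈1 , ≈ʳ-refl)

-- Sums over lists

∑ᴸ : List ℂ → (ℂ → ℂ) → ℂ
∑ᴸ xs f = foldr _+_ 0# (map f xs)

∑ᴸ-cong : ∀ {xs} {P : ℂ → Set} {f g} → (∀ {x} → P x → f x ≈ g x) → All P xs → ∑ᴸ xs f ≈ ∑ᴸ xs g
∑ᴸ-cong f≈g []        = refl {0#}
∑ᴸ-cong f≈g (px ∷ ps) = +-cong (f≈g px) (∑ᴸ-cong f≈g ps)

∑ᴸ-cong′ : ∀ xs {f g} → (∀ x → f x ≈ g x) → ∑ᴸ xs f ≈ ∑ᴸ xs g
∑ᴸ-cong′ []       f≈g = refl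
∑ᴸ-cong′ (x ∷ xs) f≈g = +-cong (f≈g x) (∑ᴸ-cong′ xs f≈g)

∑ᴸ-0# : ∀ xs → ∑ᴸ xs (λ _ → 0#) ≈ 0#
∑ᴸ-0# []       = refl
∑ᴸ-0# (x ∷ xs) = trans (+-identityˡ _) (∑ᴸ-0# xs)

∑ᴸ-distrib-+ : ∀ xs f g → ∑ᴸ xs (λ x → f x + g x) ≈ ∑ᴸ xs f + ∑ᴸ xs g
∑ᴸ-distrib-+ []       f g = sym (+-identityˡ 0#)
∑ᴸ-distrib-+ (x ∷ xs) f g = trans (+-congˡ (∑ᴸ-distrib-+ xs f g))
  (solve 4 (λ a b c d → (a :+ b) :+ (c :+ d) := (a :+ c) :+ (b :+ d)) refl (f x) (g x) (∑ᴸ xs f) (∑ᴸ xs g))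
  where open ℂ-solver

*-distribˡ-∑ᴸ : ∀ xs z f → z * ∑ᴸ xs f ≈ ∑ᴸ xs (λ x → z * f x)
*-distribˡ-∑ᴸ []       z f = zeroʳ z
*-distribˡ-∑ᴸ (x ∷ xs) z f = trans (distribˡ z (f x) (∑ᴸ xs f)) (+-congˡ (*-distribˡ-∑ᴸ xs z f))

*-distribʳ-∑ᴸ : ∀ xs z f → ∑ᴸ xs f * z ≈ ∑ᴸ xs (λ x → f x * z)
*-distribʳ-∑ᴸ []       z f = zeroˡ z
*-distribʳ-∑ᴸ (x ∷ xs) z f = trans (distribʳ z (f x) (∑ᴸ xs f)) (+-congˡ (*-distribʳ-∑ᴸ xs z f))

∑ᴸ-∑<-comm : ∀ xs n (f : ℂ → ℕ → ℂ) → ∑ᴸ xs (λ x → ∑< n (f x)) ≈ ∑< n (λ m → ∑ᴸ xs (λ x → f x m))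
∑ᴸ-∑<-comm []       n f = sym (∑<-0# n)
∑ᴸ-∑<-comm (x ∷ xs) n f = trans (+-congˡ (∑ᴸ-∑<-comm xs n f))
  (sym (∑<-distrib-+ n (f x) (λ m → ∑ᴸ xs (λ x → f x m))))

∑ᴸ-comm : ∀ xs ys (f : ℂ → ℂ → ℂ) → ∑ᴸ xs (λ x → ∑ᴸ ys (f x)) ≈ ∑ᴸ ys (λ y → ∑ᴸ xs (λ x → f x y))
∑ᴸ-comm []       ys f = sym (∑ᴸ-0# ys)
∑ᴸ-comm (x ∷ xs) ys f = trans (+-congˡ (∑ᴸ-comm xs ys f))
  (sym (∑ᴸ-distrib-+ ys (f x) (λ y → ∑ᴸ xs (λ x → f x y))))

-- Finite sums under `conj` and `ι_`

conj-∑< : ∀ n (f : ℕ → ℂ) → conj (∑< n f) ≈ ∑< n (conj ∘ f)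
conj-∑< zero    f = conj-κ 0ℚ
conj-∑< (suc n) f = trans (conj-homo-+ (f 0) (∑< n (f ∘ suc))) (+-congˡ (conj-∑< n (f ∘ suc)))

ι-homo-+ : ∀ x y → ι (x +ʳ y) ≈ ι x + ι y
ι-homo-+ x y = pointwise (λ _ → ≡.refl) (λ _ → ≡.refl)

ι-∑ʳ< : ∀ n (f : ℕ → ℝ) → ι (∑ʳ< n f) ≈ ∑< n (λ m → ι (f m))
ι-∑ʳ< zero    f = refl
ι-∑ʳ< (suc n) f = trans (ι-homo-+ (f 0) (∑ʳ< n (f ∘ suc))) (+-congˡ (ι-∑ʳ< n (f ∘ suc)))

ι-∑ʳᴸ : ∀ xs (f : ℂ → ℝ) → ι (foldr _+ʳ_ (ofℚ 0ℚ) (map f xs)) ≈ ∑ᴸ xs (λ x → ι (f x))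
ι-∑ʳᴸ []       f = refl
ι-∑ʳᴸ (x ∷ xs) f = trans (ι-homo-+ (f x) _) (+-congˡ (ι-∑ʳᴸ xs f))

-- Parseval's identity for power sums over roots of unity

module _ (n : ℕ) .{{_ : NonZero n}} where

  open Membership ℂ-setoid using (_∈_)
  open UniqueSetoid ℂ-setoid using (Unique)

  -- Orthogonality of characters: the kernel singles out the inverse `τ` of `ζ`. Whether a given
  -- entry equals `τ` is undecidable, so the recursion follows the proof of `τ ∈ xs`. The entry
  -- found there agrees with `τ` only up to `≈`, whence the congruence of `f`.
  ∑-geom-δ : ∀ {ζ τ} → RootOfUnity n ζ → ζ * τ ≈ 1# →
             ∀ {f : ℂ → ℂ} → (∀ {z w} → z ≈ w → f z ≈ f w) →
             ∀ {xs} → All (RootOfUnity n) xs → Unique xs → τ ∈ xs →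
             ∑ᴸ xs (λ ω → geom n (ζ * ω) * f ω) ≈ ofℕ n * f τ
  ∑-geom-δ {ζ} {τ} ζⁿ≈1 ζτ≈1 {f} f-cong = go
    where
    term : ℂ → ℂ
    term ω = geom n (ζ * ω) * f ω

    term-on : ∀ {ω} → τ ≈ ω → term ω ≈ ofℕ n * f τ
    term-on {ω} τ≈ω = *-cong
      (trans (fourier-cong n (λ _ → 1#) (trans (*-congˡ {ζ} (sym τ≈ω)) ζτ≈1)) (geom-1# n)) (f-cong (sym τ≈ω))

    term-off : ∀ {ω} → RootOfUnity n ω → ¬ (τ ≈ ω) → term ω ≈ 0#
    term-off {ω} ωⁿ≈1 τ≉ω = trans (*-congʳ {f ω} (geom-root≈0 {n} (rootOfUnity-* {n} {ζ} {ω} ζⁿ≈1 ωⁿ≈1) (λ ζω≈1 → τ≉ω (begin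
      τ             ≈⟨ *-identityʳ τ ⟨
      τ * 1#        ≈⟨ *-congˡ {τ} ζω≈1 ⟨
      τ * (ζ * ω)   ≈⟨ solve 3 (λ t z w → t :* (z :* w) := (z :* t) :* w) refl τ ζ ω ⟩
      (ζ * τ) * ω   ≈⟨ *-congʳ {ω} ζτ≈1 ⟩
      1# * ω        ≈⟨ *-identityˡ ω ⟩
      ω             ∎)))) (zeroˡ (f ω))
      where open ℂ-solver

    rest : ∀ {x xs} → τ ≈ x → All (RootOfUnity n) xs → All (λ y → ¬ (x ≈ y)) xs → ∑ᴸ xs term ≈ 0#
    rest τ≈x []       []         = refl {0#}
    rest {x} {y ∷ xs} τ≈x (r ∷ rs) (x≉y ∷ ps) = trans
      (+-cong {term y} {0#} {∑ᴸ xs term} {0#} (term-off r (λ τ≈y → x≉y (trans (sym τ≈x) τ≈y))) (rest τ≈x rs ps))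
      (+-identityˡ 0#)

    ≉-from-∈ : ∀ {x xs} → All (λ y → ¬ (x ≈ y)) xs → τ ∈ xs → ¬ (τ ≈ x)
    ≉-from-∈ (x≉y ∷ _) (here τ≈y) τ≈x = x≉y (trans (sym τ≈x) τ≈y)
    ≉-from-∈ (_ ∷ ps)  (there τ∈) τ≈x = ≉-from-∈ ps τ∈ τ≈x

    go : ∀ {xs} → All (RootOfUnity n) xs → Unique xs → τ ∈ xs → ∑ᴸ xs term ≈ ofℕ n * f τ
    go {x ∷ xs} (r ∷ rs) (x≉ ∷ u) (here τ≈x) = trans
      (+-cong {term x} {ofℕ n * f τ} {∑ᴸ xs term} {0#} (term-on τ≈x) (rest τ≈x rs x≉))
      (+-identityʳ (ofℕ n * f τ))
    go {x ∷ xs} (r ∷ rs) (x≉ ∷ u) (there τ∈) = trans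
      (+-cong {term x} {0#} {∑ᴸ xs term} {ofℕ n * f τ} (term-off r (≉-from-∈ x≉ τ∈)) (go rs u τ∈))
      (+-identityˡ (ofℕ n * f τ))

  module _ {Z : List ℂ} (Z-roots : All (RootOfUnity n) Z) where

    private
      a : ℕ → ℂ
      a m = ∑ᴸ Z (_^ m)

    fourier-powerSum : ∀ ω → fourier n a ω ≈ ∑ᴸ Z (λ ζ → geom n (ζ * ω))
    fourier-powerSum ω = begin
      ∑< n (λ m → a m * ω ^ m)
        ≈⟨ ∑<-cong n (λ m → *-distribʳ-∑ᴸ Z (ω ^ m) (_^ m)) ⟩
      ∑< n (λ m → ∑ᴸ Z (λ ζ → ζ ^ m * ω ^ m))
        ≈⟨ ∑ᴸ-∑<-comm Z n (λ ζ m → ζ ^ m * ω ^ m) ⟨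
      ∑ᴸ Z (λ ζ → ∑< n (λ m → ζ ^ m * ω ^ m))
        ≈⟨ ∑ᴸ-cong′ Z (λ ζ → ∑<-cong n (λ m → trans (sym (^-distrib-* ζ ω m)) (sym (*-identityˡ _)))) ⟩
      ∑ᴸ Z (λ ζ → geom n (ζ * ω)) ∎

    powerSum-parseval : (μ : Enumeration (RootOfUnity n)) →
      ∑∈ μ (λ ω → ι ∣ fourier n a ω ∣²) ≈ ofℕ n * ∑< n (λ m → ι ∣ a m ∣²)
    powerSum-parseval μ = begin
      ∑∈ μ (λ ω → ι ∣ fourier n a ω ∣²)
        ≈⟨ ∑ᴸ-cong′ μs (λ ω → sym (z*conj[z]≈∣z∣² (fourier n a ω))) ⟩
      ∑∈ μ (λ ω → fourier n a ω * c ω)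
        -- Only one factor is expanded into characters; the conjugated one stays intact as the test
        -- function that `∑-geom-δ` evaluates at `conj ζ`.
        ≈⟨ ∑ᴸ-cong′ μs (λ ω → trans (*-congʳ (fourier-powerSum ω)) (*-distribʳ-∑ᴸ Z (c ω) (λ ζ → geom n (ζ * ω)))) ⟩
      ∑∈ μ (λ ω → ∑ᴸ Z (λ ζ → geom n (ζ * ω) * c ω))
        ≈⟨ ∑ᴸ-comm μs Z (λ ω ζ → geom n (ζ * ω) * c ω) ⟩
      ∑ᴸ Z (λ ζ → ∑∈ μ (λ ω → geom n (ζ * ω) * c ω))
        ≈⟨ ∑ᴸ-cong (λ {ζ} ζⁿ≈1 → trans
             (∑-geom-δ ζⁿ≈1 (ω*conj[ω]≈1 {n} ζⁿ≈1) c-cong (Enumeration.sound μ) (Enumeration.unique μ)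
               (Enumeration.complete μ (conj ζ) (rootOfUnity-conj {n} ζⁿ≈1)))
             (*-congˡ (c∘conj ζ))) Z-roots ⟩
      ∑ᴸ Z (λ ζ → ofℕ n * ∑< n (λ m → conj (a m) * ζ ^ m))
        ≈⟨ *-distribˡ-∑ᴸ Z (ofℕ n) (λ ζ → ∑< n (λ m → conj (a m) * ζ ^ m)) ⟨
      ofℕ n * ∑ᴸ Z (λ ζ → ∑< n (λ m → conj (a m) * ζ ^ m))
        ≈⟨ *-congˡ (∑ᴸ-∑<-comm Z n (λ ζ m → conj (a m) * ζ ^ m)) ⟩
      ofℕ n * ∑< n (λ m → ∑ᴸ Z (λ ζ → conj (a m) * ζ ^ m))
        -- The sum over `Z` is again a power sum, so `a m` meets its own conjugate.
        ≈⟨ *-congˡ (∑<-cong n (λ m → trans (sym (*-distribˡ-∑ᴸ Z (conj (a m)) (_^ m)))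
             (trans (*-comm (conj (a m)) (a m)) (z*conj[z]≈∣z∣² (a m))))) ⟩
      ofℕ n * ∑< n (λ m → ι ∣ a m ∣²) ∎
      where
      μs = elements μ
      c : ℂ → ℂ
      c ω = conj (fourier n a ω)
      c-cong : ∀ {z w} → z ≈ w → c z ≈ c w
      c-cong z≈w = conj-cong (fourier-cong n a z≈w)
      c∘conj : ∀ ζ → c (conj ζ) ≈ ∑< n (λ m → conj (a m) * ζ ^ m)
      c∘conj ζ = trans (conj-∑< n (λ m → a m * conj ζ ^ m)) (∑<-cong n (λ m → trans
        (conj-homo-* (a m) (conj ζ ^ m)) (*-congˡ {conj (a m)} (trans (conj-homo-^ (conj ζ) m) (^-congˡ m (conj-conj ζ))))))
        where
        conj-conj : ∀ z → conj (conj z) ≈ z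
        conj-conj z = pointwise (λ _ → ≡.refl) (λ k → ℚ-solver.solve 1 (λ b → ℚ-solver.:- (ℚ-solver.:- b) ℚ-solver.:= b) ≡.refl (seq (im z) k))

-- Series

-- Dividing `ε` by three pays for the passage from squared moduli to the ℓ¹ norm in `∣∣²<⇒≺`.
hasSum⇒≺ : ∀ {c s} → HasSum c s → ∀ ε → 0ℚ ℚ.< ε → Eventually (λ n → ∑< n c - s ≺ ε)
hasSum⇒≺ {c} {s} c↦s ε ε>0 =
  let δ , δ>0 , 3δ≡ε = quotient {1ℚ ℚ.+ 1ℚ ℚ.+ 1ℚ} (ℚₚ.positive⁻¹ (1ℚ ℚ.+ 1ℚ ℚ.+ 1ℚ)) ε>0
  in eventually-map (λ n p → ≺-mono (ℚₚ.≤-reflexive (≡.trans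
       (solve 1 (λ d → d :+ d :+ d := (con 1ℚ :+ con 1ℚ :+ con 1ℚ) :* d) ≡.refl δ) 3δ≡ε))
       (∣∣²<⇒≺ {∑< n c - s} δ>0 p))
     (HasSum.converges c↦s δ δ>0)
  where open ℚ-solver

periodic-sum : ∀ {N a z V} → (∀ m → a (N ℕ.+ m) ≈ a m) → HasSum (λ m → a m * z ^ m) V →
               (1# - z ^ N) * V ≈ fourier N a z
periodic-sum {N} {a} {z} {V} periodic sum-V = x-y≈0⇒x≈y (≺-small⇒≈0 small)
  where
  T : ℕ → ℂ
  T n = ∑< n (λ m → a m * z ^ m)

  P : ℂ
  P = fourier N a z

  T-shift : ∀ n → T (N ℕ.+ n) ≈ P + z ^ N * T n
  T-shift n = trans (∑<-split N n (λ m → a m * z ^ m)) (+-congˡ {P} (trans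
    (∑<-cong n (λ m → begin
      a (N ℕ.+ m) * z ^ (N ℕ.+ m)   ≈⟨ *-cong (periodic m) (^-homo-* z N m) ⟩
      a m * (z ^ N * z ^ m)         ≈⟨ solve 3 (λ a z w → a :* (z :* w) := z :* (a :* w)) refl (a m) (z ^ N) (z ^ m) ⟩
      z ^ N * (a m * z ^ m)         ∎))
    (sym (*-distribˡ-∑< n (z ^ N) (λ m → a m * z ^ m)))))
    where open ℂ-solver

  -- This combination of truncation errors does not depend on `n`, while each of the two errors can
  -- be made arbitrarily small.
  error : ∀ n → z ^ N * (T n - V) - (T (N ℕ.+ n) - V) ≈ (1# - z ^ N) * V - P
  error n = begin
    z ^ N * (T n - V) - (T (N ℕ.+ n) - V)
      ≈⟨ +-congˡ {z ^ N * (T n - V)} (-‿cong (+-congʳ { - V} (T-shift n))) ⟩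
    z ^ N * (T n - V) - ((P + z ^ N * T n) - V)
      ≈⟨ solve 4 (λ u t v p → u :* (t :- v) :- ((p :+ u :* t) :- v) := (con 1ℚ :- u) :* v :- p) refl
           (z ^ N) (T n) V P ⟩
    (1# - z ^ N) * V - P ∎
    where open ℂ-solver

  small : ∀ ε → 0ℚ ℚ.< ε → (1# - z ^ N) * V - P ≺ ε
  small ε ε>0 =
    let U , zᴺ≺U = ≺-exists (z ^ N)
        δ , δ>0 , Uδ≡ε = quotient {U ℚ.+ 1ℚ} (+-pos (≺⇒0< zᴺ≺U) (ℚₚ.positive⁻¹ 1ℚ)) ε>0
        M , h = hasSum⇒≺ sum-V δ δ>0
    in ≺-resp-≈ (error M) (≺-mono
         (ℚₚ.≤-reflexive (≡.trans (solve 2 (λ u d → u :* d :+ d := (u :+ con 1ℚ) :* d) ≡.refl U δ) Uδ≡ε))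
         (≺-- (≺-* zᴺ≺U (h M ℕₚ.≤-refl)) (h (N ℕ.+ M) (ℕₚ.m≤n+m M N))))
    where open ℚ-solver

eventually-bounded⇒bounded : ∀ M {B} {c : ℕ → ℂ} → (∀ n → M ℕ.≤ n → c n ≺ B) → ∃[ C ] (∀ n → c n ≺ C)
eventually-bounded⇒bounded zero    {B} h = B , λ n → h n ℕ.z≤n
eventually-bounded⇒bounded (suc M) {B} {c} h =
  let B₀ , c₀≺B₀ = ≺-exists (c 0)
      C , k = eventually-bounded⇒bounded M {B} {c ∘ suc} (λ n le → h (suc n) (ℕ.s≤s le))
  in B₀ ℚ.⊔ C , λ where
       zero    → ≺-mono (ℚₚ.p≤p⊔q B₀ C) c₀≺B₀
       (suc n) → ≺-mono (ℚₚ.p≤q⊔p B₀ C) (k n)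

-- A late term is the difference of consecutive partial sums, both within 1 of the limit; the
-- finitely many early terms are bounded one by one.
hasSum⇒bounded-terms : ∀ {c s} → HasSum c s → ∃[ B ] (∀ n → c n ≺ B)
hasSum⇒bounded-terms {c} {s} c↦s =
  let M , h = hasSum⇒≺ c↦s 1ℚ (ℚₚ.positive⁻¹ 1ℚ)
  in eventually-bounded⇒bounded M {1ℚ ℚ.+ 1ℚ} {c} λ n le → ≺-resp-≈ (begin
       (∑< (suc n) c - s) - (∑< n c - s)
         ≈⟨ +-congʳ { - (∑< n c - s)} (+-congʳ { - s} (∑<-last n c)) ⟩
       ((∑< n c + c n) - s) - (∑< n c - s)
         ≈⟨ solve 3 (λ t c s → ((t :+ c) :- s) :- (t :- s) := c) refl (∑< n c) (c n) s ⟩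
       c n ∎)
     (≺-- (h (suc n) (ℕₚ.m≤n⇒m≤1+n le)) (h n le))
  where open ℂ-solver

-- Comparison with a geometric series

≺-κ⁺ : ∀ {p q} → 0ℚ ℚ.≤ p → p ℚ.< q → κ p ≺ q
≺-κ⁺ {p} {q} p≥0 p<q = ≺-κ (≡.subst (ℚ._< q) (≡.sym (ℚₚ.0≤p⇒∣p∣≡p p≥0)) p<q)

module _ {c : ℕ → ℂ} {B x : ℚ} (0≤x : 0ℚ ℚ.≤ x) (x<½ : x ℚ.< ℚ.½) where

  -- Horner's rule again: `B ℚ.+ B` is the fixed point of b ↦ B + b / 2, so the bound is uniform in
  -- `n`. This is where `x` below ½ enters.
  scaled-∑<-≺ : (∀ n → c n ≺ B) → ∀ n → ∑< n (λ m → κ x ^ m * c m) ≺ B ℚ.+ B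
  scaled-∑<-≺ c≺B n = go n c c≺B
    where
    go : ∀ n (c : ℕ → ℂ) → (∀ n → c n ≺ B) → ∑< n (λ m → κ x ^ m * c m) ≺ B ℚ.+ B
    go zero    c c≺B = ≺-0# (+-pos (≺⇒0< (c≺B 0)) (≺⇒0< (c≺B 0)))
    go (suc n) c c≺B = ≺-resp-≈ (sym (begin
      1# * c 0 + ∑< n (λ m → (κ x * κ x ^ m) * c (suc m))
        ≈⟨ +-cong (*-identityˡ (c 0)) (∑<-cong n (λ m → *-assoc (κ x) (κ x ^ m) (c (suc m)))) ⟩
      c 0 + ∑< n (λ m → κ x * (κ x ^ m * c (suc m)))
        ≈⟨ +-congˡ {c 0} (*-distribˡ-∑< n (κ x) (λ m → κ x ^ m * c (suc m))) ⟨
      c 0 + κ x * ∑< n (λ m → κ x ^ m * c (suc m)) ∎))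
      (≺-mono (ℚₚ.≤-reflexive (solve 1 (λ b → b :+ con ℚ.½ :* (b :+ b) := b :+ b) ≡.refl B))
        (≺-+ (c≺B 0) (≺-* (≺-κ⁺ 0≤x x<½) (go n (c ∘ suc) (c≺B ∘ suc)))))
      where open ℚ-solver

  -- The last `1ℚ` covers the distance from the limit to a partial sum. The bound is the same for
  -- all admissible `x`.
  scaled-hasSum-≺ : ∀ {d e} → (∀ n → c n ≺ B) → (∀ n → d n ≈ κ x ^ n * c n) → HasSum d e →
                    e ≺ (B ℚ.+ B) ℚ.+ 1ℚ
  scaled-hasSum-≺ {d} {e} c≺B d≈ d↦e =
    let M , h = hasSum⇒≺ d↦e 1ℚ (ℚₚ.positive⁻¹ 1ℚ)
    in ≺-resp-≈ (solve 2 (λ t e → t :- (t :- e) := e) refl (∑< M d) e)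
         (≺-- (≺-resp-≈ (sym (∑<-cong M d≈)) (scaled-∑<-≺ c≺B M)) (h M ℕₚ.≤-refl))
    where open ℂ-solver

-- Polynomials on bounded sets

fourier-bounded : ∀ n a {B} → 0ℚ ℚ.< B → ∃[ C ] (∀ {z} → z ≺ B → fourier n a z ≺ C)
fourier-bounded zero    a B>0 = 1ℚ , λ _ → ≺-0# (ℚₚ.positive⁻¹ 1ℚ)
fourier-bounded (suc n) a {B} B>0 =
  let A , a₀≺A = ≺-exists (a 0)
      C , h = fourier-bounded n (a ∘ suc) B>0
  in A ℚ.+ B ℚ.* C , λ {z} z≺B → ≺-resp-≈ (sym (fourier-suc n a z)) (≺-+ a₀≺A (≺-* z≺B (h z≺B)))

-- Mere continuity would not do: `≺-linear⇒≈0` requires errors proportional to `x`.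
fourier-lipschitz : ∀ n a {B} → 0ℚ ℚ.< B →
  ∃[ K ] (∀ {z w δ} → z ≺ B → w ≺ B → z - w ≺ δ → fourier n a z - fourier n a w ≺ K ℚ.* δ)
-- The constant 0 is ruled out by the strictness of `≺`: even the zero difference needs a positive
-- bound.
fourier-lipschitz zero    a B>0 = 1ℚ , λ {z} {w} {δ} _ _ z-w≺δ →
  ≺-resp-≈ (sym (x≈y⇒x-y≈0 (refl {0#}))) (≺-0# (*-pos (ℚₚ.positive⁻¹ 1ℚ) (≺⇒0< z-w≺δ)))
fourier-lipschitz (suc n) a {B} B>0 =
  let C , g≺C = fourier-bounded n (a ∘ suc) B>0
      K , lip = fourier-lipschitz n (a ∘ suc) B>0
      g = fourier n (a ∘ suc)
  in C ℚ.+ B ℚ.* K , λ {z} {w} {δ} z≺B w≺B z-w≺δ → ≺-resp-≈ (sym (begin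
       fourier (suc n) a z - fourier (suc n) a w
         ≈⟨ +-cong (fourier-suc n a z) (-‿cong (fourier-suc n a w)) ⟩
       (a 0 + z * g z) - (a 0 + w * g w)
         ≈⟨ ℂ-solver.solve 5 (λ a z w g h → let open ℂ-solver in
              (a :+ z :* g) :- (a :+ w :* h) := (z :- w) :* g :+ w :* (g :- h)) refl (a 0) z w (g z) (g w) ⟩
       (z - w) * g z + w * (g z - g w) ∎))
     (≺-mono (ℚₚ.≤-reflexive (ℚ-solver.solve 4 (λ d c b k → let open ℚ-solver in
         d :* c :+ b :* (k :* d) := (c :+ b :* k) :* d) ≡.refl δ C B K))
       (≺-+ (≺-* z-w≺δ (g≺C z≺B)) (≺-* w≺B (lip z≺B w≺B z-w≺δ))))

-- Polynomials that stay bounded at infinity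

polynomial : ∀ {k} → Vector ℂ k → ℂ → ℂ
polynomial β z = sum (λ j → β j * z ^ toℕ j)

polynomial-suc : ∀ {k} (β : Vector ℂ (suc k)) z → polynomial β z ≈ β zero + z * polynomial (tail β) z
polynomial-suc {k} β z = +-cong (*-identityʳ (β zero)) (begin
  sum (λ j → β (suc j) * (z * z ^ toℕ j))
    ≈⟨ sum-cong-≋ {k} (λ j → solve 3 (λ b z w → b :* (z :* w) := z :* (b :* w)) refl (β (suc j)) z (z ^ toℕ j)) ⟩
  sum (λ j → z * (β (suc j) * z ^ toℕ j))
    ≈⟨ *-distribˡ-sum {k} z (λ j → β (suc j) * z ^ toℕ j) ⟨
  z * polynomial (tail β) z ∎)
  where open ℂ-solver

x<x+x : ∀ {x} → 0ℚ ℚ.< x → x ℚ.< x ℚ.+ x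
x<x+x {x} x>0 = ≡.subst (ℚ._< x ℚ.+ x) (ℚₚ.+-identityʳ x) (ℚₚ.+-monoʳ-< x x>0)

κx≺x+x : ∀ {x} → 0ℚ ℚ.< x → κ x ≺ x ℚ.+ x
κx≺x+x x>0 = ≺-κ⁺ (ℚₚ.<⇒≤ x>0) (x<x+x x>0)

κx*κy≈1 : ∀ {x y} → x ℚ.* y ≡ 1ℚ → κ x * κ y ≈ 1#
κx*κy≈1 {x} {y} xy≡1 = trans (sym (κ-homo-* x y)) (κ-cong xy≡1)

-- Induction on the degree. If β₀ + y t(y) is bounded at y = 1 / x, then t(y) is of order x. In
-- particular `t` is bounded, hence constant by induction, and a constant of order x is 0.
polynomial-bounded-at-∞⇒constant : ∀ {k} (β : Vector ℂ (suc k)) C →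
  Near0 (λ x → ∀ y → x ℚ.* y ≡ 1ℚ → polynomial β (κ y) ≺ C) → ∀ z → polynomial β z ≈ β zero
polynomial-bounded-at-∞⇒constant {zero}  β C _ z = trans (polynomial-suc β z) (trans (+-congˡ {β zero} (zeroʳ z)) (+-identityʳ (β zero)))
polynomial-bounded-at-∞⇒constant {suc k} β C (X , X>0 , h) z = begin
  polynomial β z                       ≈⟨ polynomial-suc β z ⟩
  β zero + z * polynomial (tail β) z   ≈⟨ +-congˡ {β zero} (*-congˡ {z} (trans (tail-constant z) β₁≈0)) ⟩
  β zero + z * 0#                ≈⟨ +-congˡ {β zero} (zeroʳ z) ⟩
  β zero + 0#                    ≈⟨ +-identityʳ (β zero) ⟩
  β zero                         ∎
  where
  B₀ = proj₁ (≺-exists (β zero))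

  tail-≺ : ∀ x y → 0ℚ ℚ.< x → x ℚ.< X → x ℚ.* y ≡ 1ℚ → polynomial (tail β) (κ y) ≺ (x ℚ.+ x) ℚ.* (C ℚ.+ B₀)
  tail-≺ x y x>0 x<X xy≡1 = ≺-resp-≈ (begin
      κ x * (polynomial β (κ y) - β zero)
        ≈⟨ *-congˡ {κ x} (+-congʳ { - β zero} (polynomial-suc β (κ y))) ⟩
      κ x * ((β zero + κ y * t) - β zero)
        ≈⟨ solve 4 (λ x y b t → x :* ((b :+ y :* t) :- b) := (x :* y) :* t) refl (κ x) (κ y) (β zero) t ⟩
      (κ x * κ y) * t
        ≈⟨ *-congʳ {t} (κx*κy≈1 xy≡1) ⟩
      1# * t
        ≈⟨ *-identityˡ t ⟩
      t ∎)
    (≺-* (κx≺x+x x>0) (≺-- (h x x>0 x<X y xy≡1) (proj₂ (≺-exists (β zero)))))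
    where
    open ℂ-solver
    t = polynomial (tail β) (κ y)

  -- The sign of `C` is not given; it is read off from one instance of the bound, since `≺` forces
  -- bounds to be positive.
  D>0 : ∀ x → 0ℚ ℚ.< x → x ℚ.< X → 0ℚ ℚ.≤ C ℚ.+ B₀
  D>0 x x>0 x<X = let y , _ , xy≡1 = inverse x>0 in
    ℚₚ.<⇒≤ (+-pos (≺⇒0< (h x x>0 x<X y xy≡1)) (≺⇒0< (proj₂ (≺-exists (β zero)))))

  tail-constant : ∀ z → polynomial (tail β) z ≈ β (suc zero)
  -- Keeping `x` below 1 turns the bound proportional to `x` into a constant one, as the induction
  -- hypothesis demands.
  tail-constant = let X′ , X′>0 , X′<X , X′<1 = min-pos X>0 (ℚₚ.positive⁻¹ 1ℚ) in
    polynomial-bounded-at-∞⇒constant (tail β) ((1ℚ ℚ.+ 1ℚ) ℚ.* (C ℚ.+ B₀)) (X′ , X′>0 , λ x x>0 x<X′ y xy≡1 →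
      let x<X = ℚₚ.<-trans x<X′ X′<X
          x≤1 = ℚₚ.<⇒≤ (ℚₚ.<-trans x<X′ X′<1)
      in ≺-mono (ℚₚ.*-monoʳ-≤-nonNeg (C ℚ.+ B₀) {{ℚ.nonNegative (D>0 x x>0 x<X)}} (ℚₚ.+-mono-≤ x≤1 x≤1))
           (tail-≺ x y x>0 x<X xy≡1))

  β₁≈0 : β (suc zero) ≈ 0#
  β₁≈0 = ≺-linear⇒≈0 ((1ℚ ℚ.+ 1ℚ) ℚ.* (C ℚ.+ B₀)) (X , X>0 , λ x x>0 x<X →
    let y , _ , xy≡1 = inverse x>0 in
    ≺-mono (ℚₚ.≤-reflexive (solve 2 (λ x c → (x :+ x) :* c := ((con 1ℚ :+ con 1ℚ) :* c) :* x) ≡.refl x (C ℚ.+ B₀)))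
      (≺-resp-≈ (tail-constant (κ y)) (tail-≺ x y x>0 x<X xy≡1)))
    where open ℚ-solver

½<1 : ℚ.½ ℚ.< 1ℚ
½<1 = x<x+x (ℚₚ.positive⁻¹ ℚ.½)

-- The residue at a root of unity

-- Multiplication by `x` lowers each exponent of `y` by one, so that the residue moves into the
-- constant coefficient.
principal-part-rescale : ∀ {k} (b : Vector ℂ k) w {x y} → x * y ≈ 1# →
  x * sum (λ j → b j * (y * w) ^ suc (toℕ j)) ≈ polynomial (λ j → b j * w ^ suc (toℕ j)) y
principal-part-rescale {k} b w {x} {y} xy≈1 = trans
  (*-distribˡ-sum {k} x (λ j → b j * (y * w) ^ suc (toℕ j)))
  (sum-cong-≋ {k} (λ j → term (b j) (toℕ j)))
  where
  open ℂ-solver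
  term : ∀ b m → x * (b * (y * w) ^ suc m) ≈ (b * w ^ suc m) * y ^ m
  term b m = begin
    x * (b * (y * w) ^ suc m)
      ≈⟨ *-congˡ {x} (*-congˡ {b} (^-distrib-* y w (suc m))) ⟩
    x * (b * ((y * y ^ m) * w ^ suc m))
      ≈⟨ solve 5 (λ x b y v u → x :* (b :* ((y :* v) :* u)) := (x :* y) :* ((b :* u) :* v)) refl
           x b y (y ^ m) (w ^ suc m) ⟩
    (x * y) * ((b * w ^ suc m) * y ^ m)
      ≈⟨ *-congʳ {(b * w ^ suc m) * y ^ m} xy≈1 ⟩
    1# * ((b * w ^ suc m) * y ^ m)
      ≈⟨ *-identityˡ ((b * w ^ suc m) * y ^ m) ⟩
    (b * w ^ suc m) * y ^ m ∎

principal-part-split : ∀ {k} (b : Vector ℂ k) w {x y} V → x * y ≈ 1# →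
  x * V ≈ polynomial (λ j → b j * w ^ suc (toℕ j)) y + x * (V - sum (λ j → b j * (y * w) ^ suc (toℕ j)))
principal-part-split {k} b w {x} {y} V xy≈1 = trans
  (split V (sum (λ j → b j * (y * w) ^ suc (toℕ j))))
  (+-congʳ {x * (V - sum (λ j → b j * (y * w) ^ suc (toℕ j)))} (principal-part-rescale b w {x} {y} xy≈1))
  where
  open ℂ-solver
  split : ∀ V Q → x * V ≈ x * Q + x * (V - Q)
  split V Q = solve 3 (λ x v q → x :* v := x :* q :+ x :* (v :- q)) refl x V Q

-- As ω^N = 1, the factor 1 - z^N equals 1 - ρ^N, from which the geometric sum splits off the
-- vanishing factor 1 - ρ = σ ξ. The part `ξ` is grouped with `V` because it is their product that
-- stays bounded.
radial-equation : ∀ {N a ω σ ξ ρ z V} → (∀ m → a (N ℕ.+ m) ≈ a m) → RootOfUnity N ω →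
  ρ ≈ 1# - σ * ξ → z ≈ ρ * ω → HasSum (λ m → a m * z ^ m) V →
  (σ * geom N ρ) * (ξ * V) ≈ fourier N a z
radial-equation {N} {a} {ω} {σ} {ξ} {ρ} {z} {V} periodic root ρ≈ z≈ρω sum-V = begin
  (σ * geom N ρ) * (ξ * V)
    ≈⟨ solve 4 (λ s g x v → (s :* g) :* (x :* v) := ((con 1ℚ :- (con 1ℚ :- s :* x)) :* g) :* v) refl
         σ (geom N ρ) ξ V ⟩
  ((1# - (1# - σ * ξ)) * geom N ρ) * V
    ≈⟨ *-congʳ {V} (*-congʳ {geom N ρ} (+-congˡ {1#} (-‿cong ρ≈))) ⟨
  ((1# - ρ) * geom N ρ) * V
    ≈⟨ *-congʳ {V} (geom-telescope N ρ) ⟩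
  (1# - ρ ^ N) * V
    ≈⟨ *-congʳ {V} (+-congˡ {1#} (-‿cong zᴺ≈ρᴺ)) ⟨
  (1# - z ^ N) * V
    ≈⟨ periodic-sum {N} {a} {z} {V} periodic sum-V ⟩
  fourier N a z ∎
  where
  open ℂ-solver
  zᴺ≈ρᴺ : z ^ N ≈ ρ ^ N
  zᴺ≈ρᴺ = begin
    z ^ N            ≈⟨ ^-congˡ N z≈ρω ⟩
    (ρ * ω) ^ N      ≈⟨ ^-distrib-* ρ ω N ⟩
    ρ ^ N * ω ^ N    ≈⟨ *-congˡ {ρ ^ N} root ⟩
    ρ ^ N * 1#       ≈⟨ *-identityʳ (ρ ^ N) ⟩
    ρ ^ N            ∎

-- The situation at a single `x`: `F` is x G(z), `E` the regular part of the Laurent expansion, `D`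
-- the geometric sum at ρ and `P` the Fourier polynomial at z, with `D₀` and `P₀` as limits. The
-- constants are parameters so that they cannot vary with `x`.
record Approach {k} (β : Vector ℂ (suc k)) (σ D₀ P₀ : ℂ) (C B K K′ x y : ℚ) : Set where
  field
    F E D P u : ℂ
    laurent   : F ≈ polynomial β (κ y) + κ x * E
    algebraic : (σ * D) * F ≈ P
    E≺C       : E ≺ C
    P≺B       : P ≺ B
    D-D₀≺     : D - D₀ ≺ K ℚ.* x
    P-P₀≺     : P - P₀ ≺ K′ ℚ.* x
    D≈1+u     : D ≈ 1# + u
    u≥0       : NonNegReal u

-- The difference of both sides is a combination of `D - D₀`, `P - P₀` and `κ x * E` with bounded
-- cofactors, hence of order x. Boundedness of `F` serves twice: as such a cofactor and to make the
-- polynomial constant.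
approach-limit : ∀ {k} (β : Vector ℂ (suc k)) {σ τ} D₀ P₀ C B K K′ → τ * σ ≈ 1# →
  Near0 (λ x → ∀ y → x ℚ.* y ≡ 1ℚ → Approach β σ D₀ P₀ C B K K′ x y) →
  (σ * D₀) * β zero ≈ P₀
approach-limit {k} β {σ} {τ} D₀ P₀ C B K K′ τσ≈1 (X , X>0 , approach) =
  x-y≈0⇒x≈y (≺-linear⇒≈0 K″ (X , X>0 , λ x x>0 x<X →
    let y , _ , xy≡1 = inverse x>0 in difference x y x>0 (approach x x>0 x<X y xy≡1)))
  where
  σ̂ τ̂ δ̂ : ℚ
  σ̂ = proj₁ (≺-exists σ)
  τ̂ = proj₁ (≺-exists τ)
  δ̂ = proj₁ (≺-exists D₀)

  -- The three error contributions in `difference` after division by `x`; `C ℚ.+ C` stems from the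
  -- bound `x ℚ.+ x` on `κ x`.
  K″ : ℚ
  K″ = (σ̂ ℚ.* (K ℚ.* (τ̂ ℚ.* B)) ℚ.+ K′) ℚ.+ σ̂ ℚ.* (δ̂ ℚ.* (C ℚ.+ C))

  F-bounded : ∀ {x y} (A : Approach β σ D₀ P₀ C B K K′ x y) → Approach.F A ≺ τ̂ ℚ.* B
  F-bounded A = ≺-resp-≈ τσF≈F (≺-* (proj₂ (≺-exists τ)) (≺-cancel-1+nonNegReal {u} {σ * F} u≥0 (≺-resp-≈ P≈ P≺B)))
    where
    open Approach A
    P≈ : P ≈ (1# + u) * (σ * F)
    P≈ = begin
      P                     ≈⟨ algebraic ⟨
      (σ * D) * F           ≈⟨ *-congʳ {F} (*-congˡ {σ} D≈1+u) ⟩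
      (σ * (1# + u)) * F    ≈⟨ *-congʳ {F} (*-comm σ (1# + u)) ⟩
      ((1# + u) * σ) * F    ≈⟨ *-assoc (1# + u) σ F ⟩
      (1# + u) * (σ * F)    ∎
    τσF≈F : τ * (σ * F) ≈ F
    τσF≈F = trans (sym (*-assoc τ σ F)) (trans (*-congʳ {F} τσ≈1) (*-identityˡ F))

  constant : ∀ z → polynomial β z ≈ β zero
  constant = polynomial-bounded-at-∞⇒constant β (τ̂ ℚ.* B ℚ.+ (1ℚ ℚ.+ 1ℚ) ℚ.* C)
    (let X′ , X′>0 , X′<X , X′<1 = min-pos X>0 (ℚₚ.positive⁻¹ 1ℚ) in
     X′ , X′>0 , λ x x>0 x<X′ y xy≡1 →
       polynomial-≺ (ℚₚ.<⇒≤ x>0) (ℚₚ.<-trans x<X′ X′<1) (approach x x>0 (ℚₚ.<-trans x<X′ X′<X) y xy≡1))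
    where
    polynomial-≺ : ∀ {x y} → 0ℚ ℚ.≤ x → x ℚ.< 1ℚ → Approach β σ D₀ P₀ C B K K′ x y →
                   polynomial β (κ y) ≺ τ̂ ℚ.* B ℚ.+ (1ℚ ℚ.+ 1ℚ) ℚ.* C
    polynomial-≺ {x} {y} x≥0 x<1 A = ≺-resp-≈ (begin
        F - κ x * E                              ≈⟨ +-congʳ { - (κ x * E)} laurent ⟩
        (polynomial β (κ y) + κ x * E) - κ x * E ≈⟨ cancel (polynomial β (κ y)) (κ x * E) ⟩
        polynomial β (κ y)                       ∎)
      (≺-- (F-bounded A) (≺-* (≺-κ⁺ x≥0 (ℚₚ.<-trans x<1 (x<x+x (ℚₚ.positive⁻¹ 1ℚ)))) E≺C))
      where
      open Approach A
      cancel : ∀ a b → (a + b) - b ≈ a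
      cancel a b = solve 2 (λ a b → (a :+ b) :- b := a) refl a b
        where open ℂ-solver

  factor : ∀ x → (σ̂ ℚ.* ((K ℚ.* x) ℚ.* (τ̂ ℚ.* B)) ℚ.+ K′ ℚ.* x) ℚ.+ σ̂ ℚ.* (δ̂ ℚ.* ((x ℚ.+ x) ℚ.* C)) ≡ K″ ℚ.* x
  factor x = solve 8 (λ s k x t b k′ d c →
    (s :* ((k :* x) :* (t :* b)) :+ k′ :* x) :+ s :* (d :* ((x :+ x) :* c))
      := ((s :* (k :* (t :* b)) :+ k′) :+ s :* (d :* (c :+ c))) :* x) ≡.refl σ̂ K x τ̂ B K′ δ̂ C
    where open ℚ-solver

  difference : ∀ x y → 0ℚ ℚ.< x → Approach β σ D₀ P₀ C B K K′ x y → (σ * D₀) * β zero - P₀ ≺ K″ ℚ.* x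
  difference x y x>0 A = ≺-resp-≈ (begin
      -- Small terms only; they recombine so that `algebraic` and `F-xE≈β₀` apply to what is left.
      (σ * (- (D - D₀) * F) + (P - P₀)) - σ * (D₀ * (κ x * E))
        ≈⟨ rearrange F P (κ x * E) ⟩
      ((σ * D₀) * (F - κ x * E) - (σ * D) * F) + (P - P₀)
        ≈⟨ +-congʳ {P - P₀} (+-cong {(σ * D₀) * (F - κ x * E)} {(σ * D₀) * β zero} (*-congˡ {σ * D₀} F-xE≈β₀) (-‿cong algebraic)) ⟩
      ((σ * D₀) * β zero - P) + (P - P₀)
        ≈⟨ solve 3 (λ a p q → (a :- p) :+ (p :- q) := a :- q) refl ((σ * D₀) * β zero) P P₀ ⟩
      (σ * D₀) * β zero - P₀ ∎)
    (≺-mono (ℚₚ.≤-reflexive (factor x))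
      (≺-- (≺-+ (≺-* σ≺σ̂ (≺-* (≺-neg D-D₀≺) (F-bounded A))) P-P₀≺)
           (≺-* σ≺σ̂ (≺-* (proj₂ (≺-exists D₀)) (≺-* (κx≺x+x x>0) E≺C)))))
    where
    open Approach A
    open ℂ-solver using (solve; _:+_; _:*_; _:-_; :-_; _:=_)
    σ≺σ̂ = proj₂ (≺-exists σ)
    rearrange : ∀ F P e → (σ * (- (D - D₀) * F) + (P - P₀)) - σ * (D₀ * e)
                          ≈ ((σ * D₀) * (F - e) - (σ * D) * F) + (P - P₀)
    rearrange F P e = solve 7 (λ s d d₀ f p p₀ e →
      (s :* ((:- (d :- d₀)) :* f) :+ (p :- p₀)) :- s :* (d₀ :* e)
        := ((s :* d₀) :* (f :- e) :- (s :* d) :* f) :+ (p :- p₀)) refl σ D D₀ F P P₀ e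
    F-xE≈β₀ : F - κ x * E ≈ β zero
    F-xE≈β₀ = begin
      F - κ x * E                  ≈⟨ +-congʳ { - (κ x * E)} laurent ⟩
      (polynomial β (κ y) + κ x * E) - κ x * E
        ≈⟨ solve 2 (λ a b → (a :+ b) :- b := a) refl (polynomial β (κ y)) (κ x * E) ⟩
      polynomial β (κ y)           ≈⟨ constant (κ y) ⟩
      β zero                       ∎

geom≈1+nonNegReal : ∀ n {z} .{{_ : NonZero n}} → NonNegReal z → ∃[ u ] NonNegReal u × geom n z ≈ 1# + u
geom≈1+nonNegReal (suc n) {z} z≥0 = z * geom n z , nonNegReal-* z≥0 (geom-nonNegReal n z≥0) , geom-suc n z

∣κ*∣² : ∀ {n ω} .{{_ : NonZero n}} r → RootOfUnity n ω → ∣ κ r * ω ∣² ≈ʳ ofℚ (r ℚ.* r)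
∣κ*∣² {n} {ω} r ωⁿ≈1 = ≈ʳ-trans
  (pointwiseʳ λ k → solve 3 (λ r a b →
      (r :* a :+ :- (con 0ℚ :* b)) :* (r :* a :+ :- (con 0ℚ :* b)) :+ (r :* b :+ con 0ℚ :* a) :* (r :* b :+ con 0ℚ :* a)
        := (r :* r) :* (a :* a :+ b :* b)) ≡.refl r (seq (re ω) k) (seq (im ω) k))
  (≈ʳ-trans (*ʳ-cong {ofℚ (r ℚ.* r)} ≈ʳ-refl (∣ω∣²≈1 {n} ωⁿ≈1)) (pointwiseʳ λ k → ℚₚ.*-identityʳ (r ℚ.* r)))
  where open ℚ-solver

ω^[n∸1]*ω≈1 : ∀ n {ω} .{{_ : NonZero n}} → RootOfUnity n ω → ω ^ (n ∸ 1) * ω ≈ 1#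
ω^[n∸1]*ω≈1 (suc n) {ω} ωⁿ≈1 = trans (*-comm (ω ^ n) ω) ωⁿ≈1

[1-z]-1≈-z : ∀ z → (1# - z) - 1# ≈ - z
[1-z]-1≈-z = solve 1 (λ z → (con 1ℚ :- z) :- con 1ℚ := :- z) refl
  where open ℂ-solver

square-mono-< : ∀ {p q} → 0ℚ ℚ.< p → p ℚ.< q → p ℚ.* p ℚ.< q ℚ.* q
square-mono-< p>0 p<q = ℚₚ.<-trans (*-monoˡ-< p>0 p<q) (*-monoʳ-< (ℚₚ.<-trans p>0 p<q) p<q)

-- z x tends to ω from inside the unit disc as x → 0⁺, and w = 1 / h.
module Radial {N : ℕ} .{{_ : NonZero N}} {ω : ℂ} (root : RootOfUnity N ω) {r s t : ℚ}
              (s>0 : 0ℚ ℚ.< s) (s<r : s ℚ.< r) (s<1 : s ℚ.< 1ℚ) (st≡1 : s ℚ.* t ≡ 1ℚ) where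

  -- `h` has modulus s and points from ω towards 0, so that `z x` is (1 - s x) ω. The inverse of ω
  -- is available as the power ω^(N-1).
  h w : ℂ
  h = - (κ s * ω)
  w = - (κ t * ω ^ (N ∸ 1))

  w*h≈1 : w * h ≈ 1#
  w*h≈1 = begin
    (- (κ t * ω ^ (N ∸ 1))) * (- (κ s * ω))
      ≈⟨ solve 4 (λ t v s o → (:- (t :* v)) :* (:- (s :* o)) := (s :* t) :* (v :* o)) refl
           (κ t) (ω ^ (N ∸ 1)) (κ s) ω ⟩
    (κ s * κ t) * (ω ^ (N ∸ 1) * ω)
      ≈⟨ *-cong {κ s * κ t} {1#} {ω ^ (N ∸ 1) * ω} {1#} (κx*κy≈1 st≡1) (ω^[n∸1]*ω≈1 N root) ⟩
    1# * 1#
      ≈⟨ *-identityˡ 1# ⟩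
    1# ∎
    where open ℂ-solver

  z : ℚ → ℂ
  z x = ω + κ x * h

  ρ : ℚ → ℚ
  ρ x = 1ℚ ℚ.- s ℚ.* x

  κρ≈ : ∀ x → κ (ρ x) ≈ 1# - κ s * κ x
  κρ≈ x = trans (κ-homo-+ 1ℚ (ℚ.- (s ℚ.* x)))
    (+-congˡ {1#} (trans (κ-homo-neg (s ℚ.* x)) (-‿cong (κ-homo-* s x))))

  z≈κρω : ∀ x → z x ≈ κ (ρ x) * ω
  z≈κρω x = sym (begin
    κ (ρ x) * ω              ≈⟨ *-congʳ {ω} (κρ≈ x) ⟩
    (1# - κ s * κ x) * ω     ≈⟨ solve 3 (λ s x o → (con 1ℚ :- s :* x) :* o := o :+ x :* (:- (s :* o))) refl (κ s) (κ x) ω ⟩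
    ω + κ x * h              ∎)
    where open ℂ-solver

  z-ω≈ : ∀ x → z x - ω ≈ κ x * h
  z-ω≈ x = solve 2 (λ o d → (o :+ d) :- o := d) refl ω (κ x * h)
    where open ℂ-solver

  sx>0 : ∀ {x} → 0ℚ ℚ.< x → 0ℚ ℚ.< s ℚ.* x
  sx>0 = *-pos s>0

  sx<s : ∀ {x} → x ℚ.< 1ℚ → s ℚ.* x ℚ.< s
  sx<s {x} x<1 = ≡.subst (s ℚ.* x ℚ.<_) (ℚₚ.*-identityʳ s) (*-monoˡ-< s>0 x<1)

  ρ>0 : ∀ {x} → x ℚ.< 1ℚ → 0ℚ ℚ.< ρ x
  ρ>0 {x} x<1 = ≡.subst (ℚ._< ρ x) (ℚₚ.+-inverseʳ (s ℚ.* x))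
    (ℚₚ.+-monoˡ-< (ℚ.- (s ℚ.* x)) (ℚₚ.<-trans (sx<s x<1) s<1))

  ρ<1 : ∀ {x} → 0ℚ ℚ.< x → ρ x ℚ.< 1ℚ
  ρ<1 {x} x>0 = ≡.subst (ρ x ℚ.<_) (ℚₚ.+-identityʳ 1ℚ) (ℚₚ.+-monoʳ-< 1ℚ (ℚₚ.neg-antimono-< (sx>0 x>0)))

  z∈unit-disc : ∀ {x} → 0ℚ ℚ.< x → x ℚ.< 1ℚ → ∣ z x ∣² <ʳ ofℚ 1ℚ
  z∈unit-disc {x} x>0 x<1 = <ʳ-respˡ-≈ʳ (≈ʳ-trans (∣∣²-cong (z≈κρω x)) (∣κ*∣² {N} (ρ x) root))
    (square-mono-< (ρ>0 x<1) (ρ<1 x>0))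

  -- Formulated through `s ℚ.* x` to include x = 1, the reference point for bounding the Laurent
  -- terms.
  z∈disc : ∀ {x} → 0ℚ ℚ.< x → s ℚ.* x ℚ.< r → InDisc ω r (z x)
  z∈disc {x} x>0 sx<r = <ʳ-respˡ-≈ʳ (≈ʳ-trans (∣∣²-cong z-ω≈′)
      (≈ʳ-trans (∣κ*∣² {N} (ℚ.- (s ℚ.* x)) root)
        (pointwiseʳ λ _ → ℚ-solver.solve 1 (λ p → let open ℚ-solver in (:- p) :* (:- p) := p :* p) ≡.refl (s ℚ.* x))))
    (square-mono-< (sx>0 x>0) sx<r)
    where
    z-ω≈′ : z x - ω ≈ κ (ℚ.- (s ℚ.* x)) * ω
    z-ω≈′ = trans (z-ω≈ x) (sym (begin
      κ (ℚ.- (s ℚ.* x)) * ω   ≈⟨ *-congʳ {ω} (trans (κ-homo-neg (s ℚ.* x)) (-‿cong (κ-homo-* s x))) ⟩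
      (- (κ s * κ x)) * ω     ≈⟨ solve 3 (λ s x o → (:- (s :* x)) :* o := x :* (:- (s :* o))) refl (κ s) (κ x) ω ⟩
      κ x * h                 ∎))
      where open ℂ-solver

  z<1∈disc : ∀ {x} → 0ℚ ℚ.< x → x ℚ.< 1ℚ → InDisc ω r (z x)
  z<1∈disc x>0 x<1 = z∈disc x>0 (ℚₚ.<-trans (sx<s x<1) s<r)

  inverse-z-ω : ∀ {x y} → x ℚ.* y ≡ 1ℚ → (κ y * w) * (z x - ω) ≈ 1#
  inverse-z-ω {x} {y} xy≡1 = begin
    (κ y * w) * (z x - ω)       ≈⟨ *-congˡ {κ y * w} (z-ω≈ x) ⟩
    (κ y * w) * (κ x * h)       ≈⟨ solve 4 (λ y w x h → (y :* w) :* (x :* h) := (x :* y) :* (w :* h)) refl (κ y) w (κ x) h ⟩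
    (κ x * κ y) * (w * h)       ≈⟨ *-cong {κ x * κ y} {1#} {w * h} {1#} (κx*κy≈1 xy≡1) w*h≈1 ⟩
    1# * 1#                     ≈⟨ *-identityˡ 1# ⟩
    1#                          ∎
    where open ℂ-solver

  rescale : ∀ (c : ℕ → ℂ) x n → c n * (z x - ω) ^ n ≈ κ x ^ n * (c n * h ^ n)
  rescale c x n = begin
    c n * (z x - ω) ^ n         ≈⟨ *-congˡ {c n} (trans (^-congˡ n (z-ω≈ x)) (^-distrib-* (κ x) h n)) ⟩
    c n * (κ x ^ n * h ^ n)     ≈⟨ swap (c n) (κ x ^ n) (h ^ n) ⟩
    κ x ^ n * (c n * h ^ n)     ∎
    where
    open ℂ-solver
    swap : ∀ a b c → a * (b * c) ≈ b * (a * c)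
    swap = solve 3 (λ a b c → a :* (b :* c) := b :* (a :* c)) refl

  z-≺ : ∃[ B ] 0ℚ ℚ.< B × ω ≺ B × (∀ {x} → 0ℚ ℚ.< x → x ℚ.< 1ℚ → z x ≺ B)
  z-≺ = let A , ω≺A = ≺-exists ω
            H , h≺H = ≺-exists h
        in A ℚ.+ 1ℚ ℚ.* H
         , +-pos (≺⇒0< ω≺A) (*-pos (ℚₚ.positive⁻¹ 1ℚ) (≺⇒0< h≺H))
         , ≺-mono (p≤p+q (ℚₚ.<⇒≤ (*-pos (ℚₚ.positive⁻¹ 1ℚ) (≺⇒0< h≺H)))) ω≺A
         , λ x>0 x<1 → ≺-+ ω≺A (≺-* (≺-κ⁺ (ℚₚ.<⇒≤ x>0) x<1) h≺H)

  fourier-z-lipschitz : ∀ a → ∃[ K ] (∀ {x} → 0ℚ ℚ.< x → x ℚ.< 1ℚ → fourier N a (z x) - fourier N a ω ≺ K ℚ.* x)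
  fourier-z-lipschitz a =
    let B , B>0 , ω≺B , z≺B = z-≺
        H , h≺H = ≺-exists h
        K , lip = fourier-lipschitz N a B>0
    in K ℚ.* (H ℚ.+ H) , λ {x} x>0 x<1 → ≺-mono
         (ℚₚ.≤-reflexive (solve 3 (λ k x h → k :* ((x :+ x) :* h) := (k :* (h :+ h)) :* x) ≡.refl K x H))
         (lip (z≺B x>0 x<1) ω≺B (≺-resp-≈ (sym (z-ω≈ x)) (≺-* (κx≺x+x x>0) h≺H)))
    where open ℚ-solver

  geom-ρ-lipschitz : ∃[ K ] (∀ {x} → 0ℚ ℚ.< x → x ℚ.< 1ℚ → geom N (κ (ρ x)) - geom N 1# ≺ K ℚ.* x)
  geom-ρ-lipschitz =
    let K , lip = fourier-lipschitz N (λ _ → 1#) {1ℚ ℚ.+ 1ℚ} (ℚₚ.positive⁻¹ (1ℚ ℚ.+ 1ℚ))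
        1<2 = x<x+x (ℚₚ.positive⁻¹ 1ℚ)
    in K ℚ.* ((s ℚ.+ s) ℚ.+ (s ℚ.+ s)) , λ {x} x>0 x<1 → ≺-mono
         (ℚₚ.≤-reflexive (solve 3 (λ k x s → k :* ((s :+ s) :* (x :+ x)) := (k :* ((s :+ s) :+ (s :+ s))) :* x) ≡.refl K x s))
         (lip (≺-κ⁺ (ℚₚ.<⇒≤ (ρ>0 x<1)) (ℚₚ.<-trans (ρ<1 x>0) 1<2)) (≺-κ⁺ (ℚₚ.<⇒≤ (ℚₚ.positive⁻¹ 1ℚ)) 1<2)
           (≺-resp-≈ (κρ-1≈ x) (≺-neg (≺-* (κx≺x+x s>0) (κx≺x+x x>0)))))
    where
    open ℚ-solver
    κρ-1≈ : ∀ x → - (κ s * κ x) ≈ κ (ρ x) - 1#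
    κρ-1≈ x = sym (begin
      κ (ρ x) - 1#               ≈⟨ +-congʳ { - 1#} (κρ≈ x) ⟩
      (1# - κ s * κ x) - 1#      ≈⟨ [1-z]-1≈-z (κ s * κ x) ⟩
      - (κ s * κ x)              ∎)

module _ {N : ℕ} .{{_ : NonZero N}} {a : ℕ → ℂ} (periodic : ∀ m → a (N ℕ.+ m) ≈ a m)
         (G : PartialFunction) (extends : ∀ z → ∣ z ∣² <ʳ ofℚ 1ℚ → ValueIsSum G z (λ m → a m * z ^ m))
         {ω : ℂ} (root : RootOfUnity N ω) (L : LaurentAt G ω)
         where

  private
    module L = LaurentAt L

  module _ {s t : ℚ} (s>0 : 0ℚ ℚ.< s) (s<r : s ℚ.< L.radius) (s<1 : s ℚ.< 1ℚ) (st≡1 : s ℚ.* t ≡ 1ℚ) where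

    open Radial {N} {ω} root {L.radius} {s} {t} s>0 s<r s<1 st≡1

    -- Convergence at the single point x = 1 replaces uniform convergence: every other point of the
    -- ray only gains factors x^n, as in `rescale`.
    terms-bounded : ∃[ B ] (∀ n → L.coeff n * h ^ n ≺ B)
    terms-bounded =
      let _ , sum = L.expansion (z 1ℚ) (κ 1ℚ * w)
            (z∈disc {1ℚ} (ℚₚ.positive⁻¹ 1ℚ) (≡.subst (ℚ._< L.radius) (≡.sym (ℚₚ.*-identityʳ s)) s<r))
            (inverse-z-ω {1ℚ} {1ℚ} ≡.refl)
          B , bounded = hasSum⇒bounded-terms sum
      in B , λ n → ≺-resp-≈ {L.coeff n * (z 1ℚ - ω) ^ n} {L.coeff n * h ^ n}
           (*-congˡ {L.coeff n} (^-congˡ n (trans (z-ω≈ 1ℚ) (*-identityˡ h)))) (bounded n)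

    -- The coefficients of x times the principal part, as a polynomial in 1 / x; the constant one is
    -- the residue divided by `h`.
    β : Vector ℂ (suc L.order)
    β j = L.principal j * w ^ suc (toℕ j)

    B C Bᴾ Kᴳ Kᴾ : ℚ
    B  = proj₁ terms-bounded
    C  = (B ℚ.+ B) ℚ.+ 1ℚ
    Bᴾ = proj₁ (fourier-bounded N a (proj₁ (proj₂ z-≺)))
    Kᴳ = proj₁ geom-ρ-lipschitz
    Kᴾ = proj₁ (fourier-z-lipschitz a)

    approach : ∀ x → 0ℚ ℚ.< x → x ℚ.< ℚ.½ → ∀ y → x ℚ.* y ≡ 1ℚ →
      Approach β (κ s) (geom N 1#) (fourier N a ω) C Bᴾ Kᴳ Kᴾ x y
    approach x x>0 x<½ y xy≡1 =
      let x<1 = ℚₚ.<-trans x<½ ½<1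
          d , sum-E = L.expansion (z x) (κ y * w) (z<1∈disc x>0 x<1) (inverse-z-ω {x} {y} xy≡1)
          d′ , sum-V = extends (z x) (z∈unit-disc x>0 x<1)
          V = PartialFunction.value G (z x) d
          V′ = PartialFunction.value G (z x) d′
          u , u≥0 , geom≈ = geom≈1+nonNegReal N (nonNegReal-κ (ℚₚ.<⇒≤ (ρ>0 x<1)))
      in record
      { F = κ x * V
      ; E = V - sum (λ j → L.principal j * (κ y * w) ^ suc (toℕ j))
      ; D = geom N (κ (ρ x))
      ; P = fourier N a (z x)
      ; u = u
      ; laurent = principal-part-split L.principal w {κ x} {κ y} V (κx*κy≈1 xy≡1)
      -- The Laurent expansion and the power series come with different proofs `d` and `d′` that the
      -- point lies in the domain; `value-cong` identifies the two values.
      ; algebraic = trans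
          (*-congˡ {κ s * geom N (κ (ρ x))} (*-congˡ {κ x} (PartialFunction.value-cong G d d′ (refl {z x}))))
          (radial-equation {N} {a} {ω} {κ s} {κ x} {κ (ρ x)} {z x} {V′} periodic root (κρ≈ x) (z≈κρω x) sum-V)
      ; E≺C = scaled-hasSum-≺ {λ n → L.coeff n * h ^ n} {B} {x} (ℚₚ.<⇒≤ x>0) x<½
          (proj₂ terms-bounded) (rescale L.coeff x) sum-E
      ; P≺B = proj₂ (fourier-bounded N a (proj₁ (proj₂ z-≺))) (proj₂ (proj₂ (proj₂ z-≺)) x>0 x<1)
      ; D-D₀≺ = proj₂ geom-ρ-lipschitz x>0 x<1
      ; P-P₀≺ = proj₂ (fourier-z-lipschitz a) x>0 x<1
      ; D≈1+u = geom≈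
      ; u≥0 = u≥0
      }

    limit : (κ s * geom N 1#) * β zero ≈ fourier N a ω
    limit = approach-limit β {κ s} {κ t} (geom N 1#) (fourier N a ω) C Bᴾ Kᴳ Kᴾ
      (trans (*-comm (κ t) (κ s)) (κx*κy≈1 st≡1)) (ℚ.½ , ℚₚ.positive⁻¹ ℚ.½ , approach)

    fourier-residue′ : fourier N a ω ≈ - ((ofℕ N * ω ^ (N ∸ 1)) * L.principal zero)
    fourier-residue′ = begin
      fourier N a ω
        ≈⟨ limit ⟨
      (κ s * geom N 1#) * (L.principal zero * (w * 1#))
        ≈⟨ *-congʳ {L.principal zero * (w * 1#)} (*-congˡ {κ s} (geom-1# N)) ⟩
      (κ s * ofℕ N) * (L.principal zero * (w * 1#))
        -- The scale `s` split off from 1 - z^N meets the `t` in `w` and disappears; the minus sign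
        -- also comes from `w`.
        ≈⟨ rearrange (κ s) (ofℕ N) (L.principal zero) (κ t) (ω ^ (N ∸ 1)) ⟩
      (κ s * κ t) * (- ((ofℕ N * ω ^ (N ∸ 1)) * L.principal zero))
        ≈⟨ *-congʳ { - ((ofℕ N * ω ^ (N ∸ 1)) * L.principal zero)} (κx*κy≈1 st≡1) ⟩
      1# * (- ((ofℕ N * ω ^ (N ∸ 1)) * L.principal zero))
        ≈⟨ *-identityˡ (- ((ofℕ N * ω ^ (N ∸ 1)) * L.principal zero)) ⟩
      - ((ofℕ N * ω ^ (N ∸ 1)) * L.principal zero) ∎
      where
      rearrange : ∀ s n b t v → (s * n) * (b * ((- (t * v)) * 1#)) ≈ (s * t) * (- ((n * v) * b))
      rearrange = solve 5 (λ s n b t v → (s :* n) :* (b :* ((:- (t :* v)) :* con 1ℚ))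
        := (s :* t) :* (:- ((n :* v) :* b))) refl
        where open ℂ-solver

  fourier-residue : fourier N a ω ≈ - (ofℕ N * ω ^ (N ∸ 1) * L.principal zero)
  fourier-residue =
    -- `s` below the radius keeps the ray inside the Laurent disc, and `s` below 1 keeps ρ positive.
    let s , s>0 , s<r , s<1 = min-pos L.radius>0 (ℚₚ.positive⁻¹ 1ℚ)
        t , _ , st≡1 = inverse s>0
    in fourier-residue′ {s} {t} s>0 s<r s<1 st≡1

-- The sum of squared moduli of the residues

-- Verified on unnormalised fractions, where no reduction to lowest terms blocks the computation.
1/n*n≡1 : ∀ n .{{_ : NonZero n}} → ((+ 1) ℚ./ n) ℚ.* ((+ n) ℚ./ 1) ≡ 1ℚ
1/n*n≡1 (suc n) = ℚₚ.toℚᵘ-injective (ℚᵘₚ.≃-trans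
  (ℚₚ.toℚᵘ-homo-* ((+ 1) ℚ./ suc n) ((+ suc n) ℚ./ 1)) (ℚᵘₚ.≃-trans
  (ℚᵘₚ.*-cong (ℚₚ.toℚᵘ-fromℚᵘ (ℚᵘ.mkℚᵘ (+ 1) n)) (ℚₚ.toℚᵘ-fromℚᵘ (ℚᵘ.mkℚᵘ (+ suc n) 0)))
  (ℚᵘ.*≡* (≡.cong (λ k → + suc k) (≡.trans (ℕₚ.*-identityʳ (n ℕ.+ 0))
    (≡.cong (ℕ._+ 0) (≡.sym (ℕₚ.*-identityʳ n))))))))

rootOfUnity-^ : ∀ {n z} k → RootOfUnity n z → RootOfUnity n (z ^ k)
rootOfUnity-^ {n} zero    zⁿ≈1 = 1^n≈1 n
rootOfUnity-^ {n} {z} (suc k) zⁿ≈1 = rootOfUnity-* {n} {z} {z ^ k} zⁿ≈1 (rootOfUnity-^ {n} {z} k zⁿ≈1)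

ι-homo-* : ∀ x y → ι (x *ʳ y) ≈ ι x * ι y
ι-homo-* x y = pointwise
  (λ n → solve 2 (λ a b → a :* b := a :* b :+ :- (con 0ℚ :* con 0ℚ)) ≡.refl (seq x n) (seq y n))
  (λ n → solve 2 (λ a b → con 0ℚ := a :* con 0ℚ :+ con 0ℚ :* b) ≡.refl (seq x n) (seq y n))
  where open ℚ-solver

ι-injective : ∀ {x y} → ι x ≈ ι y → x ≈ʳ y
ι-injective = _≈ᶜ_.re≈

ι∣∣²-cong : ∀ {z w} → z ≈ w → ι ∣ z ∣² ≈ ι ∣ w ∣²
ι∣∣²-cong z≈w = ∣∣²-cong z≈w , ≈ʳ-refl

∣-z∣² : ∀ z → ι ∣ - z ∣² ≈ ι ∣ z ∣²
∣-z∣² z = pointwise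
  (λ n → solve 2 (λ a b → (:- a) :* (:- a) :+ (:- b) :* (:- b) := a :* a :+ b :* b) ≡.refl (seq (re z) n) (seq (im z) n))
  (λ _ → ≡.refl)
  where open ℚ-solver

∣z*w∣² : ∀ z w → ι ∣ z * w ∣² ≈ ι ∣ z ∣² * ι ∣ w ∣²
∣z*w∣² z w = begin
  ι ∣ z * w ∣²                       ≈⟨ z*conj[z]≈∣z∣² (z * w) ⟨
  (z * w) * conj (z * w)             ≈⟨ *-congˡ {z * w} (conj-homo-* z w) ⟩
  (z * w) * (conj z * conj w)        ≈⟨ solve 4 (λ z w z′ w′ → (z :* w) :* (z′ :* w′) := (z :* z′) :* (w :* w′)) refl
                                          z w (conj z) (conj w) ⟩
  (z * conj z) * (w * conj w)        ≈⟨ *-cong (z*conj[z]≈∣z∣² z) (z*conj[z]≈∣z∣² w) ⟩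
  ι ∣ z ∣² * ι ∣ w ∣²                ∎
  where open ℂ-solver

∣ofℕ∣² : ∀ n → ι ∣ ofℕ n ∣² ≈ ofℕ n * ofℕ n
∣ofℕ∣² n = trans (sym (z*conj[z]≈∣z∣² (ofℕ n))) (*-congˡ {ofℕ n} (conj-κ ((+ n) ℚ./ 1)))

∣n*v*R∣² : ∀ N .{{_ : NonZero N}} {v} R → RootOfUnity N v →
  ι ∣ - (ofℕ N * v * R) ∣² ≈ (ofℕ N * ofℕ N) * ι ∣ R ∣²
∣n*v*R∣² N {v} R root = begin
  ι ∣ - (ofℕ N * v * R) ∣²                ≈⟨ ∣-z∣² (ofℕ N * v * R) ⟩
  ι ∣ ofℕ N * v * R ∣²                    ≈⟨ ∣z*w∣² (ofℕ N * v) R ⟩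
  ι ∣ ofℕ N * v ∣² * ι ∣ R ∣²             ≈⟨ *-congʳ {ι ∣ R ∣²} (∣z*w∣² (ofℕ N) v) ⟩
  (ι ∣ ofℕ N ∣² * ι ∣ v ∣²) * ι ∣ R ∣²    ≈⟨ *-congʳ {ι ∣ R ∣²} (*-cong (∣ofℕ∣² N) (∣ω∣²≈1 {N} {v} root , ≈ʳ-refl)) ⟩
  ((ofℕ N * ofℕ N) * 1#) * ι ∣ R ∣²       ≈⟨ *-congʳ {ι ∣ R ∣²} (*-identityʳ (ofℕ N * ofℕ N)) ⟩
  (ofℕ N * ofℕ N) * ι ∣ R ∣²              ∎

powerSum-periodic : ∀ {N Z} → All (RootOfUnity N) Z → ∀ m → ∑ᴸ Z (_^ (N ℕ.+ m)) ≈ ∑ᴸ Z (_^ m)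
powerSum-periodic {N} roots m = ∑ᴸ-cong {P = RootOfUnity N} (λ {ζ} ζᴺ≈1 → trans (^-homo-* ζ N m)
  (trans (*-congʳ {ζ ^ m} ζᴺ≈1) (*-identityˡ (ζ ^ m)))) roots

residue-parseval : ∀ N .{{_ : NonZero N}} {Z} → All (RootOfUnity N) Z → (μ : Enumeration (RootOfUnity N)) →
  (R : ℂ → ℂ) →
  (∀ ω → RootOfUnity N ω → fourier N (λ m → ∑ᴸ Z (_^ m)) ω ≈ - (ofℕ N * ω ^ (N ∸ 1) * R ω)) →
  recip N *ʳ ∑ʳ< N (λ m → ∣ ∑ᴸ Z (_^ m) ∣²) ≈ʳ ∑ʳ∈ μ (λ ω → ∣ R ω ∣²)
residue-parseval N {Z} roots μ R residue = ι-injective (begin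
  ι (recip N *ʳ ∑ʳ< N (λ m → ∣ a m ∣²))
    ≈⟨ trans (ι-homo-* (recip N) (∑ʳ< N (λ m → ∣ a m ∣²))) (*-congˡ {ν} (ι-∑ʳ< N (λ m → ∣ a m ∣²))) ⟩
  ν * A
    -- The inserted `ν * n` rewrites 1/N as N/N²: Parseval absorbs the N, and the relation |P(ω)|² =
    -- N² |R(ω)|² the 1/N².
    ≈⟨ *-congʳ {A} (trans (sym (*-identityʳ ν)) (*-congˡ {ν} (sym νn≈1))) ⟩
  (ν * (ν * n)) * A
    ≈⟨ solve 3 (λ v n a → (v :* (v :* n)) :* a := (v :* v) :* (n :* a)) refl ν n A ⟩
  (ν * ν) * (n * A)
    ≈⟨ *-congˡ {ν * ν} (powerSum-parseval N roots μ) ⟨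
  (ν * ν) * ∑∈ μ (λ ω → ι ∣ fourier N a ω ∣²)
    ≈⟨ *-distribˡ-∑ᴸ (elements μ) (ν * ν) (λ ω → ι ∣ fourier N a ω ∣²) ⟩
  ∑∈ μ (λ ω → (ν * ν) * ι ∣ fourier N a ω ∣²)
    ≈⟨ ∑ᴸ-cong {P = RootOfUnity N} (λ {ω} → term ω) (Enumeration.sound μ) ⟩
  ∑∈ μ (λ ω → ι ∣ R ω ∣²)
    ≈⟨ ι-∑ʳᴸ (elements μ) (λ ω → ∣ R ω ∣²) ⟨
  ι (∑ʳ∈ μ (λ ω → ∣ R ω ∣²)) ∎)
  where
  open ℂ-solver
  a : ℕ → ℂ
  a m = ∑ᴸ Z (_^ m)
  ν n A : ℂ
  ν = κ ((+ 1) ℚ./ N)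
  n = ofℕ N
  A = ∑< N (λ m → ι ∣ a m ∣²)
  νn≈1 : ν * n ≈ 1#
  νn≈1 = κx*κy≈1 (1/n*n≡1 N)
  term : ∀ ω → RootOfUnity N ω → (ν * ν) * ι ∣ fourier N a ω ∣² ≈ ι ∣ R ω ∣²
  term ω root = begin
    (ν * ν) * ι ∣ fourier N a ω ∣²
      ≈⟨ *-congˡ {ν * ν} (trans (ι∣∣²-cong (residue ω root))
           (∣n*v*R∣² N (R ω) (rootOfUnity-^ {N} {ω} (N ∸ 1) root))) ⟩
    (ν * ν) * ((n * n) * ι ∣ R ω ∣²)
      ≈⟨ solve 3 (λ v n r → (v :* v) :* ((n :* n) :* r) := (v :* n) :* ((v :* n) :* r)) refl ν n (ι ∣ R ω ∣²) ⟩
    (ν * n) * ((ν * n) * ι ∣ R ω ∣²)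
      ≈⟨ *-cong νn≈1 (trans (*-congʳ {ι ∣ R ω ∣²} νn≈1) (*-identityˡ (ι ∣ R ω ∣²))) ⟩
    1# * ι ∣ R ω ∣²
      ≈⟨ *-identityˡ (ι ∣ R ω ∣²) ⟩
    ι ∣ R ω ∣² ∎

corollary3p12 : (p q : ℕ) .{{_ : NonZero p}} .{{_ : NonZero q}} → Coprime p q →
    (Z : Enumeration (AlexanderZero p q)) (μ : Enumeration (RootOfUnity (p ℕ.* q))) →
    (G : PartialFunction) → IsMeromorphicExtension (S p q Z) G →
    (R : ℂ → ℂ) → (∀ ω → RootOfUnity (p ℕ.* q) ω → HasResidue G ω (R ω)) →
    (∀ ω → RootOfUnity (p ℕ.* q) ω →
    fourier (p ℕ.* q) (S p q Z) ω ≈ - (ofℕ (p ℕ.* q) * ω ^ (p ℕ.* q ∸ 1) * R ω))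
    ×
    (recip (p ℕ.* q) {{m*n≢0 p q}} *ʳ ∑ʳ< (p ℕ.* q) (λ m → ∣ S p q Z m ∣²)
    ≈ʳ ∑ʳ∈ μ (λ ω → ∣ R ω ∣²))
corollary3p12 p q _ Z μ G ext R residues = transform , residue-parseval N {{N≢0}} roots μ R transform
  where
  N : ℕ
  N = p ℕ.* q

  N≢0 : NonZero N
  N≢0 = m*n≢0 p q

  roots : All (RootOfUnity N) (elements Z)
  roots = All.map proj₁ (Enumeration.sound Z)

  transform : ∀ ω → RootOfUnity N ω → fourier N (S p q Z) ω ≈ - (ofℕ N * ω ^ (N ∸ 1) * R ω)
  transform ω root =
    let L , principal≈R = residues ω root in
    trans (fourier-residue {N} {{N≢0}} {S p q Z} (powerSum-periodic {N} {elements Z} roots) G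
             (IsMeromorphicExtension.extends ext) {ω} root L)
          (-‿cong (*-congˡ {ofℕ N * ω ^ (N ∸ 1)} principal≈R))
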